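{- Let $(G,I)$ be a single interval mean-payoff game, i.e. $I$ is a single real interval. If Adam has a winning strategy then he has a positional winning strategy. If Eve has a winning strategy then she has a winning strategy that requires only finite memory.
   Context: A game graph is a tuple $G=(V,V_\exists,E,w,q_0)$ where $(V,E)$ is a finite directed graph in which every vertex has an outgoing edge, $w:E\to\mathbb{Z}$ is an integer edge-weight function, $V_\exists\subseteq V$ are Eve's vertices (the rest are Adam's), and $q_0\in V$ is the initial vertex. A play is an infinite path $\pi=v_0v_1\cdots$ with $v_0=q_0$; write $w(\pi[..k])=\sum_{i=0}^{k-1}w(v_i,v_{i+1})$. A strategy for a player maps finite play prefixes ending in one of that player's vertices to a successor vertex; it is positional if it depends only on the last vertex, and has finite memory if it can be realized as the output of a finite-state machine reading the play. The (liminf) mean-payoff is $\underline{MP}(\pi)=\liminf_{k\to\infty}\frac1k w(\pi[..k])$. A play is winning for Eve iff $\underline{MP}(\pi)\in I$, and winning for Adam otherwise; a strategy is winning for a player if every play consistent with it is winning for that player.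
   Formalization: The claim about Eve is proved under the added assumption that if I is a single point then that point is rational; for I = {α} with α irrational Eve may win but never with finite memory. The claim about Adam is for every real interval. -}

module Defs where

open import Data.Bool.Base using (Bool; true; false; T)
open import Data.Fin.Base using (Fin)
open import Data.Integer.Base as ℤ using (ℤ)
open import Data.Nat.Base as ℕ using (ℕ; zero; suc)
open import Data.Product.Base using (Σ-syntax; ∃-syntax; _×_; _,_; proj₁)
open import Data.Rational.Base as ℚ using (ℚ; 1ℚ)
open import Data.Rational.Properties as ℚₚ using (<-dense; <-trans; <-asym; <-cmp)
open import Data.Sum.Base using (_⊎_; inj₁; inj₂)
open import Data.Unit.Base using (⊤)
open import Relation.Binary.Definitions using (tri<; tri≈; tri>)
open import Relation.Binary.PropositionalEquality using (_≡_; refl; subst)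
open import Relation.Nullary using (¬_)

-- Two-sided Dedekind cuts: lower q means q < x, upper q means x < q.
record ℝ : Set₁ where
  field
    lower upper     : ℚ → Set
    lower-inhabited : ∃[ q ] lower q
    upper-inhabited : ∃[ q ] upper q
    lower-closed    : ∀ {p q} → p ℚ.< q → lower q → lower p
    upper-closed    : ∀ {p q} → p ℚ.< q → upper p → upper q
    lower-rounded   : ∀ {p} → lower p → ∃[ q ] (p ℚ.< q × lower q)
    upper-rounded   : ∀ {q} → upper q → ∃[ p ] (p ℚ.< q × upper p)
    disjoint        : ∀ {q} → ¬ (lower q × upper q)
    located         : ∀ {p q} → p ℚ.< q → lower p ⊎ upper q

open ℝ public

infix 4 _≤_ _<_ _≈_

_≤_ _<_ _≈_ : ℝ → ℝ → Set
x ≤ y = ∀ q → lower x q → lower y q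
x < y = ∃[ q ] (upper x q × lower y q)
x ≈ y = x ≤ y × y ≤ x

private
  p-1<p : ∀ p → p ℚ.- 1ℚ ℚ.< p
  p-1<p p = subst (p ℚ.- 1ℚ ℚ.<_) (ℚₚ.+-identityʳ p)
    (ℚₚ.+-monoʳ-< p (ℚₚ.negative⁻¹ (ℚ.- 1ℚ)))

  p<p+1 : ∀ p → p ℚ.< p ℚ.+ 1ℚ
  p<p+1 p = subst (ℚ._< p ℚ.+ 1ℚ) (ℚₚ.+-identityʳ p)
    (ℚₚ.+-monoʳ-< p (ℚₚ.positive⁻¹ 1ℚ))

  ℚ-located : ∀ r {p q} → p ℚ.< q → p ℚ.< r ⊎ r ℚ.< q
  ℚ-located r {p} {q} p<q with <-cmp p r
  ... | tri< p<r _ _ = inj₁ p<r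
  ... | tri≈ _ refl _ = inj₂ p<q
  ... | tri> _ _ r<p = inj₂ (<-trans r<p p<q)

fromℚ : ℚ → ℝ
fromℚ r = record
  { lower           = ℚ._< r
  ; upper           = r ℚ.<_
  ; lower-inhabited = r ℚ.- 1ℚ , p-1<p r
  ; upper-inhabited = r ℚ.+ 1ℚ , p<p+1 r
  ; lower-closed    = <-trans
  ; upper-closed    = λ p<q r<p → <-trans r<p p<q
  ; lower-rounded   = <-dense
  ; upper-rounded   = λ r<q → let (m , r<m , m<q) = <-dense r<q in m , m<q , r<m
  ; disjoint        = λ (q<r , r<q) → <-asym q<r r<q
  ; located         = ℚ-located r
  }

IsInfimum : (ℕ → ℝ) → ℝ → Set₁
IsInfimum a x = (∀ k → x ≤ a k) × (∀ y → (∀ k → y ≤ a k) → y ≤ x)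

IsSupremum : (ℕ → ℝ) → ℝ → Set₁
IsSupremum a x = (∀ k → a k ≤ x) × (∀ y → (∀ k → a k ≤ y) → x ≤ y)

-- x = supₙ inf_{k ≥ n} a k, where m n is the inner infimum.
IsLiminf : (ℕ → ℝ) → ℝ → Set₁
IsLiminf a x = Σ[ m ∈ (ℕ → ℝ) ]
  ((∀ n → IsInfimum (λ k → a (n ℕ.+ k)) (m n)) × IsSupremum m x)

data Endpoint : Set₁ where
  infinite  : Endpoint
  inclusive : ℝ → Endpoint
  exclusive : ℝ → Endpoint

record Interval : Set₁ where
  field
    left right : Endpoint

RightOf : Endpoint → ℝ → Set
RightOf infinite      x = ⊤
RightOf (inclusive a) x = a ≤ x
RightOf (exclusive a) x = a < x

LeftOf : Endpoint → ℝ → Set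
LeftOf infinite      x = ⊤
LeftOf (inclusive b) x = x ≤ b
LeftOf (exclusive b) x = x < b

infix 4 _∈ᴵ_

_∈ᴵ_ : ℝ → Interval → Set
x ∈ᴵ I = RightOf (Interval.left I) x × LeftOf (Interval.right I) x

-- If I consists of a single point, that point is rational.  This holds in
-- particular whenever I is empty, or non-degenerate, or has rational endpoints.
-- Eve can need infinite memory for I = {α} with α irrational: let her alone
-- choose, at every step, between weights 0 and 1, with 0 < α < 1.
NotIrrationalPoint : Interval → Set₁
NotIrrationalPoint I = ∀ x → x ∈ᴵ I → (∀ y → y ∈ᴵ I → y ≈ x) → ∃[ q ] x ≈ fromℚ q

data Player : Set where
  eve adam : Player

record GameGraph : Set where
  field
    order : ℕ

  V : Set
  V = Fin order

  field
    V∃ : V → Bool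
    E  : V → V → Bool

  Edge : V → V → Set
  Edge u v = T (E u v)

  field
    total : ∀ u → ∃[ v ] Edge u v
    w     : ∀ {u v} → Edge u v → ℤ
    q₀    : V

module _ (G : GameGraph) where
  open GameGraph G

  Owns : Player → V → Set
  Owns eve  v = V∃ v ≡ true
  Owns adam v = V∃ v ≡ false

  -- Finite play prefixes, indexed by their last vertex.
  data Prefix : V → Set where
    start : ∀ {v} → v ≡ q₀ → Prefix v
    _▷_   : ∀ {u v} → Prefix u → Edge u v → Prefix v

  record Play : Set where
    field
      vertex : ℕ → V
      starts : vertex 0 ≡ q₀
      step   : ∀ i → Edge (vertex i) (vertex (suc i))

  open Play

  prefix : (π : Play) (k : ℕ) → Prefix (vertex π k)
  prefix π zero    = start (starts π)
  prefix π (suc k) = prefix π k ▷ step π k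

  weight : Play → ℕ → ℤ
  weight π zero    = ℤ.0ℤ
  weight π (suc k) = weight π k ℤ.+ w (step π k)

  -- The averages are indexed from k = 1, so entry k is w(π[..k+1]) / (k+1).
  average : Play → ℕ → ℚ
  average π k = weight π (suc k) ℚ./ suc k

  IsMeanPayoff : Play → ℝ → Set₁
  IsMeanPayoff π x = IsLiminf (λ k → fromℚ (average π k)) x

  Strategy : Player → Set
  Strategy p = ∀ {v} → Prefix v → Owns p v → Σ[ u ∈ V ] Edge v u

  Consistent : ∀ {p} → Strategy p → Play → Set
  Consistent {p} σ π = ∀ k (o : Owns p (vertex π k)) →
    vertex π (suc k) ≡ proj₁ (σ (prefix π k) o)

  Positional : ∀ {p} → Strategy p → Set
  Positional {p} σ = Σ[ f ∈ (V → V) ]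
    (∀ {v} (h : Prefix v) (o : Owns p v) → proj₁ (σ h o) ≡ f v)

  record Machine : Set where
    field
      size    : ℕ
      initial : Fin size
      update  : Fin size → V → Fin size
      output  : Fin size → V

  -- The state after reading every vertex of the prefix, the last one included.
  run : (M : Machine) → ∀ {v} → Prefix v → Fin (Machine.size M)
  run M {v} (start _) = Machine.update M (Machine.initial M) v
  run M {v} (h ▷ _)   = Machine.update M (run M h) v

  FiniteMemory : ∀ {p} → Strategy p → Set
  FiniteMemory {p} σ = Σ[ M ∈ Machine ]
    (∀ {v} (h : Prefix v) (o : Owns p v) → proj₁ (σ h o) ≡ Machine.output M (run M h))

  module _ (I : Interval) where

    WonBy : Player → Play → Set₁
    WonBy eve  π = Σ[ x ∈ ℝ ] (IsMeanPayoff π x × x ∈ᴵ I)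
    WonBy adam π = ¬ WonBy eve π

    Winning : ∀ {p} → Strategy p → Set₁
    Winning {p} σ = ∀ π → Consistent {p} σ π → WonBy p π

{-# OPTIONS --safe #-}
module Submission where

-- Suppose no positional strategy of Adam wins.  Then Eve has a controller under which
-- a k - C ≤ W ≤ b k + C for all finite plays of length k and weight W, with a and b in I and a constant C;
-- this puts the mean-payoff in [a , b].  The proof is by induction on the set of moves left to Adam.
--
-- If Adam can choose between u₁ and u₂ at v, Eve has a controller for each of the two games in which one
-- of these moves is deleted.  She cuts the play at its visits to v and gives every excursion from v to the
-- controller that allows it.  The play is then a shuffle of two controlled plays, and the bounds add up.
-- (For liminf alone this would fail: the bound W ≤ b k + C, stronger than liminf ≤ b, is essential.)
--
-- If Adam has no choice left, his only strategy loses, so some play has its mean-payoff x in I.  In the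
-- strongly connected part where that play ends up, x lies between the least and the greatest cycle mean.
-- Eve either repeats one cycle whose mean is a rational point of I, or, when I = {x} with x irrational,
-- combines a cycle of mean below x with one of mean above x so as to stay near x k.

open import Axiom.ExcludedMiddle using (ExcludedMiddle)
open import Axiom.UniquenessOfIdentityProofs using (module Decidable⇒UIP)
open import Data.Bool.Base using (true; false)
import Data.Bool.Properties as Boolₚ
open import Data.Fin.Base as Fin using (Fin; toℕ; fromℕ<; inject≤; combine; remQuot)
import Data.Fin.Properties as Finₚ
open import Data.Fin.Subset using (Subset; _∈_; _⊂_) renaming (_-_ to _∖_; ⊤ to full)
open import Data.Fin.Subset.Induction using (⊂-wellFounded)
open import Data.Fin.Subset.Properties using (x∈p⇒p-x⊂p; x∈p∧x≢y⇒x∈p-y; ∈⊤)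
open import Data.Integer.Base as ℤ using (ℤ; +_; -[1+_]; 0ℤ; 1ℤ; ∣_∣; _+_; _*_; _-_; -_)
import Data.Integer.Properties as ℤₚ
open import Data.Integer.Tactic.RingSolver using (solve-∀)
open import Data.Nat.Base as ℕ using (ℕ; zero; suc)
open import Data.Nat.Induction using (<-rec)
import Data.Nat.Properties as ℕₚ
open import Data.Product.Base using (Σ-syntax; ∃-syntax; _×_; _,_; proj₁; proj₂)
open import Data.Rational.Base as ℚ using (ℚ; ↥_; ↧_)
open import Data.Rational.Literals using (fromℤ)
import Data.Rational.Properties as ℚₚ
open import Algebra.Properties.Group ℚₚ.+-0-group using (⁻¹-involutive)
import Data.Rational.Unnormalised.Base as ℚᵘ
import Data.Rational.Unnormalised.Properties as ℚᵘₚ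
open import Data.Sum.Base using (_⊎_; inj₁; inj₂)
open import Data.Unit.Base using (tt)
open import Induction.WellFounded using (Acc; acc)
open import Level using (0ℓ; Lift; lift) renaming (suc to lsuc; lower to unlift)
open import Relation.Binary.Definitions using (tri<; tri≈; tri>)
open import Relation.Binary.PropositionalEquality using (_≡_; _≢_; refl; sym; trans; cong; cong₂; subst; subst₂)
open import Relation.Nullary using (¬_; Dec; yes; no; contradiction)
open import Relation.Nullary.Decidable using (map′; decidable-stable)
open import Defs

open Decidable⇒UIP Boolₚ._≟_ using (≡-irrelevant)

-- Linear bounds on weights

≤-by-difference : ∀ {i j} d → 0ℤ ℤ.≤ d → j - i ≡ d → i ℤ.≤ j
≤-by-difference d 0≤d eq = ℤₚ.0≤i-j⇒j≤i (subst (0ℤ ℤ.≤_) (sym eq) 0≤d)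

0≤* : ∀ {i j} → 0ℤ ℤ.≤ i → 0ℤ ℤ.≤ j → 0ℤ ℤ.≤ i * j
0≤* {+ m} {+ n} _ _ = subst (0ℤ ℤ.≤_) (ℤₚ.pos-* m n) (ℤ.+≤+ ℕ.z≤n)

0≤+ : ∀ {i j} → 0ℤ ℤ.≤ i → 0ℤ ℤ.≤ j → 0ℤ ℤ.≤ i + j
0≤+ = ℤₚ.+-mono-≤

0≤+n : ∀ {n} → 0ℤ ℤ.≤ + n
0≤+n = ℤ.+≤+ ℕ.z≤n

0≤gap : ∀ {i j} → i ℤ.≤ j → 0ℤ ℤ.≤ j - i
0≤gap = ℤₚ.i≤j⇒0≤j-i

0≤gap-< : ∀ {i j} → i ℤ.< j → 0ℤ ℤ.≤ j - (1ℤ + i)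
0≤gap-< i<j = 0≤gap (ℤₚ.i<j⇒suc[i]≤j i<j)

i≤+∣i∣ : ∀ i → i ℤ.≤ + ∣ i ∣
i≤+∣i∣ (+ n)    = ℤₚ.≤-refl
i≤+∣i∣ -[1+ n ] = ℤ.-≤+

0≤i+∣i∣ : ∀ i → 0ℤ ℤ.≤ i + + ∣ i ∣
0≤i+∣i∣ (+ n)    = 0≤+n
0≤i+∣i∣ -[1+ n ] = ℤₚ.≤-reflexive (sym (ℤₚ.+-inverseˡ (+ suc n)))

1≤↧ : ∀ r → 1ℤ ℤ.≤ ↧ r
1≤↧ r = ℤ.+≤+ (ℕ.s≤s ℕ.z≤n)

0≤↧ : ∀ r → 0ℤ ℤ.≤ ↧ r
0≤↧ r = 0≤+n

cancel-0≤ : ∀ d {y} .{{_ : ℤ.Positive d}} → 0ℤ ℤ.≤ d * y → 0ℤ ℤ.≤ y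
cancel-0≤ d {y} p = ℤₚ.*-cancelˡ-≤-pos 0ℤ y d (subst (ℤ._≤ d * y) (sym (ℤₚ.*-zeroʳ d)) p)

infix 4 _·_≼_

-- The inequality r · k ≤ W with denominators cleared.
record _·_≼_ (r : ℚ) (k : ℕ) (W : ℤ) : Set where
  constructor ≼⁺
  field ≼⁻ : ↥ r * + k ℤ.≤ ↧ r * W

open _·_≼_ public

≼-mono : ∀ {r r′ k W} → r ℚ.≤ r′ → r′ · k ≼ W → r · k ≼ W
≼-mono {r} {r′} {k} {W} r≤r′ h = ≼⁺ (ℤₚ.0≤i-j⇒j≤i (cancel-0≤ (↧ r′) (subst (0ℤ ℤ.≤_)
  (identity (↥ r) (↧ r) (↥ r′) (↧ r′) (+ k) W)
  (0≤+ (0≤* (0≤↧ r) (0≤gap (≼⁻ h))) (0≤* (0≤gap (ℚₚ.drop-*≤* r≤r′)) (0≤+n {k}))))))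
  where
  identity : ∀ n d n′ d′ k W →
    d * (d′ * W - n′ * k) + (n′ * d - n * d′) * k ≡ d′ * (d * W - n * k)
  identity = solve-∀

-- With denominators cleared the gap between `r` and `r′` is a positive integer, hence at least 1.
-- Over `k` steps it gains at least `k`, which outweighs `C` times both denominators once `k`
-- reaches that product.
≼-eventually : ∀ {r r′} C → r ℚ.< r′ → ∃[ K ] (∀ {k W} → K ℕ.≤ k →
  r′ · k ≼ W + + C → r · k ≼ W)
≼-eventually {r} {r′} C r<r′ = D ℕ.* C , λ {k} {W} K≤k h →
  ≼⁺ (ℤₚ.0≤i-j⇒j≤i (cancel-0≤ (↧ r′) (subst (0ℤ ℤ.≤_)
  (identity (↥ r) (↧ r) (↥ r′) (↧ r′) (+ k) W (+ C))
  (0≤+ (0≤+ (0≤* (0≤↧ r) (0≤gap (≼⁻ h))) (0≤* (0≤gap-< (ℚₚ.drop-*<* r<r′)) (0≤+n {k})))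
       (0≤gap (subst (ℤ._≤ + k) (trans (ℤₚ.pos-* D C) (cong (_* + C) (ℤₚ.pos-* (ℚ.↧ₙ r) (ℚ.↧ₙ r′))))
         (ℤ.+≤+ K≤k)))))))
  where
  D = ℚ.↧ₙ r ℕ.* ℚ.↧ₙ r′

  identity : ∀ n d n′ d′ k W C →
    d * (d′ * (W + C) - n′ * k) + (n′ * d - (1ℤ + n * d′)) * k + (k - d * d′ * C)
    ≡ d′ * (d * W - n * k)
  identity = solve-∀

-- Dropping `k₀` steps of weight `W₀` costs `W₀ - r k₀`, and `r ≥ r₀ ≥ -∣ ↥ r₀ ∣` bounds this
-- independently of `r`.
≼-cancel : ∀ {r₀ r C k W} → r₀ ℚ.≤ r → ∀ k₀ W₀ → r · k₀ ℕ.+ k ≼ W₀ + W + + C →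
  r · k ≼ W + + (C ℕ.+ (∣ ↥ r₀ ∣ ℕ.* k₀ ℕ.+ ∣ W₀ ∣))
≼-cancel {r₀} {r} {C} {k} {W} r₀≤r k₀ W₀ h = ≼⁺ (≤-by-difference _
  (0≤+ (0≤+ (0≤gap (≼⁻ h))
    (0≤* (cancel-0≤ (↧ r₀) (subst (0ℤ ℤ.≤_) (identity₁ (↥ r) (↧ r) (↥ r₀) (↧ r₀) (+ ∣ ↥ r₀ ∣))
      (0≤+ (0≤gap (ℚₚ.drop-*≤* r₀≤r)) (0≤+ (0≤* (0≤↧ r) (0≤i+∣i∣ (↥ r₀)))
        (0≤* (0≤↧ r) (0≤* (0≤gap (1≤↧ r₀)) 0≤+n)))))) (0≤+n {k₀})))
    (0≤* (0≤↧ r) (0≤gap (i≤+∣i∣ W₀))))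
  (trans (cong (λ z → ↧ r * (W + (+ C + (z + + ∣ W₀ ∣))) - ↥ r * + k) (ℤₚ.pos-* ∣ ↥ r₀ ∣ k₀))
    (identity₂ (↥ r) (↧ r) (+ k) (+ k₀) W W₀ (+ C) (+ ∣ ↥ r₀ ∣) (+ ∣ W₀ ∣))))
  where
  identity₁ : ∀ n d n₀ d₀ A →
    (n * d₀ - n₀ * d) + (d * (n₀ + A) + d * ((d₀ - 1ℤ) * A)) ≡ d₀ * (n + d * A)
  identity₁ = solve-∀

  identity₂ : ∀ n d k k₀ W W₀ C A B → d * (W + (C + (A * k₀ + B))) - n * k ≡
    (d * (W₀ + W + C) - n * (k₀ + k)) + (n + d * A) * k₀ + d * (B - W₀)
  identity₂ = solve-∀

≼-zero : ∀ {r} → r · 0 ≼ 0ℤ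
≼-zero {r} = ≼⁺ (ℤₚ.≤-reflexive (trans (ℤₚ.*-zeroʳ (↥ r)) (sym (ℤₚ.*-zeroʳ (↧ r)))))

≼-+ : ∀ {r k k′ W W′} → r · k ≼ W → r · k′ ≼ W′ → r · k ℕ.+ k′ ≼ W + W′
≼-+ {r} {k} {k′} {W} {W′} h h′ = ≼⁺ (≤-by-difference _
  (0≤+ (0≤gap (≼⁻ h)) (0≤gap (≼⁻ h′))) (identity (↥ r) (↧ r) (+ k) (+ k′) W W′))
  where
  identity : ∀ n d k k′ W W′ → d * (W + W′) - n * (k + k′) ≡ (d * W - n * k) + (d * W′ - n * k′)
  identity = solve-∀

neg-≼⁻ : ∀ q {k W} → (ℚ.- q) · k ≼ - W → ↧ q * W ℤ.≤ ↥ q * + k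
neg-≼⁻ q {k} {W} h = ≤-by-difference _
  (0≤gap (subst₂ (λ n d → n * + k ℤ.≤ d * (- W)) (ℚₚ.↥-neg q) (ℚₚ.↧-neg q) (≼⁻ h)))
  (identity (↥ q) (↧ q) (+ k) W)
  where
  identity : ∀ n d k W → n * k - d * W ≡ d * (- W) - (- n) * k
  identity = solve-∀

neg-≼⁺ : ∀ q {k W} → ↧ q * W ℤ.≤ ↥ q * + k → (ℚ.- q) · k ≼ - W
neg-≼⁺ q {k} {W} h = ≼⁺
  (subst₂ (λ n d → n * + k ℤ.≤ d * (- W)) (sym (ℚₚ.↥-neg q)) (sym (ℚₚ.↧-neg q))
    (≤-by-difference _ (0≤gap h) (identity (↥ q) (↧ q) (+ k) W)))
  where
  identity : ∀ n d k W → d * (- W) - (- n) * k ≡ n * k - d * W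
  identity = solve-∀

≼⇒≤/ : ∀ {q W k} → q · suc k ≼ W → q ℚ.≤ W ℚ./ suc k
≼⇒≤/ {q@record{}} {W} {k} h = ℚₚ.toℚᵘ-cancel-≤
  (ℚᵘₚ.≤-respʳ-≃ (ℚᵘₚ.≃-sym (ℚₚ.toℚᵘ-fromℚᵘ (ℚᵘ.mkℚᵘ W k)))
    (ℚᵘ.*≤* (subst (↥ q * + suc k ℤ.≤_) (ℤₚ.*-comm (↧ q) W) (≼⁻ h))))

≤/⇒≼ : ∀ {q W k} → q ℚ.≤ W ℚ./ suc k → q · suc k ≼ W
≤/⇒≼ {q@record{}} {W} {k} h = ≼⁺ (subst (↥ q * + suc k ℤ.≤_) (ℤₚ.*-comm W (↧ q))
  (ℚᵘₚ.drop-*≤* (ℚᵘₚ.≤-respʳ-≃ (ℚₚ.toℚᵘ-fromℚᵘ (ℚᵘ.mkℚᵘ W k)) (ℚₚ.toℚᵘ-mono-≤ h))))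

neg-≼⇒/≤ : ∀ {q W k} → (ℚ.- q) · suc k ≼ - W → W ℚ./ suc k ℚ.≤ q
neg-≼⇒/≤ {q@record{}} {W} {k} h = ℚₚ.toℚᵘ-cancel-≤
  (ℚᵘₚ.≤-respˡ-≃ (ℚᵘₚ.≃-sym (ℚₚ.toℚᵘ-fromℚᵘ (ℚᵘ.mkℚᵘ W k)))
    (ℚᵘ.*≤* (subst (ℤ._≤ ↥ q * + suc k) (ℤₚ.*-comm (↧ q) W) (neg-≼⁻ q h))))

/≤⇒neg-≼ : ∀ {q W k} → W ℚ./ suc k ℚ.≤ q → (ℚ.- q) · suc k ≼ - W
/≤⇒neg-≼ {q@record{}} {W} {k} h = neg-≼⁺ q (subst (ℤ._≤ ↥ q * + suc k) (ℤₚ.*-comm W (↧ q))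
  (ℚᵘₚ.drop-*≤* (ℚᵘₚ.≤-respˡ-≃ (ℚₚ.toℚᵘ-fromℚᵘ (ℚᵘ.mkℚᵘ W k)) (ℚₚ.toℚᵘ-mono-≤ h))))

-- The slope is a real number, given by its rational approximations from below; one constant `C` has
-- to serve all of them.
record Bound (L : ℚ → Set) (C k : ℕ) (W : ℤ) : Set where
  constructor bound
  field bound-at : ∀ {r} → L r → r · k ≼ W + + C

open Bound public

-- Above a C k W says a · k ≤ W + C, and Below b C k W says W ≤ b · k + C.
Above Below : ℝ → ℕ → ℕ → ℤ → Set
Above a = Bound (lower a)
Below b C k W = Bound (λ r → upper b (ℚ.- r)) C k (- W)

module _ {L : ℚ → Set} where

  bound-+ : ∀ {C C′ k k′ W W′} → Bound L C k W → Bound L C′ k′ W′ →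
    Bound L (C ℕ.+ C′) (k ℕ.+ k′) (W + W′)
  bound-+ {C} {C′} {W = W} {W′} b b′ = bound λ Lr →
    subst (_ · _ ≼_) (identity W W′ (+ C) (+ C′)) (≼-+ (bound-at b Lr) (bound-at b′ Lr))
    where
    identity : ∀ W W′ C C′ → (W + C) + (W′ + C′) ≡ (W + W′) + (C + C′)
    identity = solve-∀

  bound-weaken : ∀ {C C′ k W} → C ℕ.≤ C′ → Bound L C k W → Bound L C′ k W
  bound-weaken {W = W} C≤C′ b = bound λ {r} Lr → ≼⁺ (ℤₚ.≤-trans (≼⁻ (bound-at b Lr))
    (ℤₚ.*-monoˡ-≤-nonNeg (↧ r) (ℤₚ.+-monoʳ-≤ W (ℤ.+≤+ C≤C′))))

  bound-crude : ∀ q → (∀ {r} → L r → ↥ r ℤ.≤ ↧ r * + q) →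
    ∀ k W → Bound L (q ℕ.* k ℕ.+ ∣ W ∣) k W
  bound-crude q L≤q k W = bound λ {r} Lr → ≼⁺ (≤-by-difference _
    (0≤+ (0≤* (0≤gap (L≤q Lr)) (0≤+n {k})) (0≤* (0≤↧ r) (0≤i+∣i∣ W)))
    (trans (cong (λ z → ↧ r * (W + (z + + ∣ W ∣)) - ↥ r * + k) (ℤₚ.pos-* q k))
      (identity (↥ r) (↧ r) (+ k) W (+ q) (+ ∣ W ∣))))
    where
    identity : ∀ n d k W q A → d * (W + (q * k + A)) - n * k ≡ (d * q - n) * k + d * (W + A)
    identity = solve-∀

  -- A single `r₀` in `L` fixes the constant: slopes above `r₀` are covered by `≼-cancel`, and
  -- slopes below it follow from the case of `r₀` by monotonicity.
  bound-cancel : ∀ {r₀} → L r₀ → ∀ {C k W} k₀ W₀ → Bound L C (k₀ ℕ.+ k) (W₀ + W) →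
    Bound L (C ℕ.+ (∣ ↥ r₀ ∣ ℕ.* k₀ ℕ.+ ∣ W₀ ∣)) k W
  bound-cancel {r₀} Lr₀ {C} {k} {W} k₀ W₀ b = bound cancelled
    where
    cancelled : ∀ {r} → L r → r · k ≼ W + + (C ℕ.+ (∣ ↥ r₀ ∣ ℕ.* k₀ ℕ.+ ∣ W₀ ∣))
    cancelled {r} Lr with ℚₚ.≤-total r₀ r
    ... | inj₁ r₀≤r = ≼-cancel r₀≤r k₀ W₀ (bound-at b Lr)
    ... | inj₂ r≤r₀ = ≼-mono r≤r₀ (≼-cancel (ℚₚ.≤-refl {r₀}) k₀ W₀ (bound-at b Lr₀))

-- Limits inferior of averages

≤-trans : ∀ {x y z} → x ≤ y → y ≤ z → x ≤ z
≤-trans x≤y y≤z q = λ l → y≤z q (x≤y q l)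

lower<upper : ∀ x {p q} → lower x p → upper x q → p ℚ.< q
lower<upper x {p} {q} lp uq with ℚₚ.<-cmp p q
... | tri< p<q _ _  = p<q
... | tri≈ _ refl _ = contradiction (lp , uq) (disjoint x)
... | tri> _ _ q<p  = contradiction (lower-closed x q<p lp , uq) (disjoint x)

module _ (W : ℕ → ℤ) where

  Average : ℕ → ℚ
  Average k = W (suc k) ℚ./ suc k

  Liminf : ℝ → Set₁
  Liminf = IsLiminf (λ k → fromℚ (Average k))

  bounded⇒liminf-≥ : ∀ {a x C N} → Liminf x → (∀ k → N ℕ.≤ k → Above a C k (W k)) → a ≤ x
  bounded⇒liminf-≥ {a} {x} {C} {N} (m , inf , sup) b q lq =
    -- Two rationals are put between `q` and `a`: the gap from `q₁` to `q₂` absorbs the constant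
    -- `C`, and the gap from `q` to `q₁` provides the strict inequality of the cut.
    let (q₁ , q<q₁ , l₁) = lower-rounded a lq
        (q₂ , q₁<q₂ , l₂) = lower-rounded a l₁
        (K , ev) = ≼-eventually C q₁<q₂
        n = N ℕ.⊔ K
        tail : ∀ j → fromℚ q₁ ≤ fromℚ (Average (n ℕ.+ j))
        tail j p p<q₁ = ℚₚ.<-≤-trans p<q₁ (≼⇒≤/ {W = W (suc (n ℕ.+ j))} (ev
          (ℕₚ.≤-trans (ℕₚ.m≤n⊔m N K) (ℕₚ.≤-trans (ℕₚ.m≤m+n n j) (ℕₚ.n≤1+n _)))
          (bound-at (b (suc (n ℕ.+ j)) (ℕₚ.≤-trans (ℕₚ.m≤m⊔n N K) (ℕₚ.≤-trans (ℕₚ.m≤m+n n j) (ℕₚ.n≤1+n _)))) l₂)))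
    in proj₁ sup n q (proj₂ (inf n) (fromℚ q₁) tail q q<q₁)

  -- It suffices to bound each tail infimum `m n`. If it exceeded `b`, some `q₁` below `m n` would
  -- lie above a rational `p` that is itself above `b`. All averages past `n` then exceed `q₁`, yet
  -- the bound with slope `p` pushes the late ones down to `q₁`.
  bounded⇒liminf-≤ : ∀ {b x C N} → Liminf x → (∀ k → N ℕ.≤ k → Below b C k (W k)) → x ≤ b
  bounded⇒liminf-≤ {b} {x} {C} {N} (m , inf , sup) bnd = proj₂ sup b m≤b
    where
    m≤b : ∀ n → m n ≤ b
    m≤b n q lq with lower-rounded (m n) lq
    ... | q₁ , q<q₁ , l₁ with located b q<q₁
    ...   | inj₁ lbq = lbq
    ...   | inj₂ ubq₁ with upper-rounded b ubq₁
    ...     | p , p<q₁ , ubp = contradiction (ℚₚ.<-≤-trans q₁<avg avg≤q₁) (ℚₚ.<-irrefl refl)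
      where
      ev = ≼-eventually C (ℚₚ.neg-antimono-< p<q₁)
      j  = N ℕ.+ proj₁ ev
      k  = suc (n ℕ.+ j)
      q₁<avg : q₁ ℚ.< Average (n ℕ.+ j)
      q₁<avg = proj₁ (inf n) j q₁ l₁
      avg≤q₁ : Average (n ℕ.+ j) ℚ.≤ q₁
      avg≤q₁ = neg-≼⇒/≤ {W = W k} (proj₂ ev
        (ℕₚ.≤-trans (ℕₚ.m≤n+m (proj₁ ev) N) (ℕₚ.≤-trans (ℕₚ.m≤n+m j n) (ℕₚ.n≤1+n _)))
        (bound-at (bnd k (ℕₚ.≤-trans (ℕₚ.m≤m+n N (proj₁ ev)) (ℕₚ.≤-trans (ℕₚ.m≤n+m j n) (ℕₚ.n≤1+n _))))
          (subst (upper b) (sym (⁻¹-involutive p)) ubp)))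

finite-max : ∀ {n} {P : Fin n → ℕ → Set} → (∀ i {c c′} → c ℕ.≤ c′ → P i c → P i c′) →
  (∀ i → ∃[ c ] P i c) → ∃[ c ] (∀ i → P i c)
finite-max {zero}  mono p = 0 , λ ()
finite-max {suc n} mono p with p Fin.zero | finite-max (λ i → mono (Fin.suc i)) (λ i → p (Fin.suc i))
... | c , pc | d , pd = c ℕ.⊔ d , λ where
  Fin.zero    → mono Fin.zero (ℕₚ.m≤m⊔n c d) pc
  (Fin.suc i) → mono (Fin.suc i) (ℕₚ.m≤n⊔m c d) (pd i)

lower-≤ : ∀ x {p q} → p ℚ.≤ q → lower x q → lower x p
lower-≤ x {p} {q} p≤q lq with ℚₚ.<-cmp p q
... | tri< p<q _ _  = lower-closed x p<q lq
... | tri≈ _ refl _ = lq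
... | tri> _ _ q<p  = contradiction (ℚₚ.<-≤-trans q<p p≤q) (ℚₚ.<-irrefl refl)

upper-≤ : ∀ x {p q} → p ℚ.≤ q → upper x p → upper x q
upper-≤ x {p} {q} p≤q up with ℚₚ.<-cmp p q
... | tri< p<q _ _  = upper-closed x p<q up
... | tri≈ _ refl _ = up
... | tri> _ _ q<p  = contradiction (ℚₚ.<-≤-trans q<p p≤q) (ℚₚ.<-irrefl refl)

≤-upper : ∀ {x y} → x ≤ y → ∀ {q} → upper y q → upper x q
≤-upper {x} {y} x≤y {q} uy with upper-rounded y uy
... | p , p<q , up with located x p<q
...   | inj₁ lp = contradiction (x≤y p lp , up) (disjoint y)
...   | inj₂ uq = uq

≤-fromℚ : ∀ {x q} → upper x q → x ≤ fromℚ q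
≤-fromℚ {x} uq p lp = lower<upper x lp uq

fromℚ-≤ : ∀ {x q} → lower x q → fromℚ q ≤ x
fromℚ-≤ {x} lq p p<q = lower-closed x p<q lq

∈ᴵ-convex : ∀ {a x b} I → a ∈ᴵ I → b ∈ᴵ I → a ≤ x → x ≤ b → x ∈ᴵ I
∈ᴵ-convex {a} {x} {b} I (a∈ , _) (_ , b∈) a≤x x≤b =
  right-of (Interval.left I) a∈ , left-of (Interval.right I) b∈
  where
  right-of : ∀ e → RightOf e a → RightOf e x
  right-of infinite      _ = tt
  right-of (inclusive l) l≤a = ≤-trans {l} {a} {x} l≤a a≤x
  right-of (exclusive l) (q , u , lq) = q , u , a≤x q lq

  left-of : ∀ e → LeftOf e b → LeftOf e x
  left-of infinite      _ = tt
  left-of (inclusive r) b≤r = ≤-trans {x} {b} {r} x≤b b≤r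
  left-of (exclusive r) (q , u , lq) = q , ≤-upper {x} {b} x≤b u , lq

-- Classical existence of infima, suprema and limits inferior

module Classical (em : ExcludedMiddle (lsuc 0ℓ)) where

  em₀ : (P : Set) → Dec P
  em₀ P = map′ unlift lift (em {Lift (lsuc 0ℓ) P})

  ≤-or-> : ∀ x y → x ≤ y ⊎ y < x
  ≤-or-> x y with em₀ (y < x)
  ... | yes y<x = inj₂ y<x
  ... | no  y≮x = inj₁ x≤y
    where
    x≤y : x ≤ y
    x≤y q lq with lower-rounded x lq
    ... | q′ , q<q′ , lq′ with located y q<q′
    ...   | inj₁ lyq  = lyq
    ...   | inj₂ uyq′ = contradiction (q′ , uyq′ , lq′) y≮x

  <⇒≤ : ∀ x y → x < y → x ≤ y
  <⇒≤ x y (q , ux , ly) p lp = lower-closed y (lower<upper x lp ux) ly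

  -- The down-closed set `L` may have a greatest element, as the rationals below every term of a
  -- sequence can; so both sides are rounded by hand. Locatedness comes from deciding `L` at a point
  -- between `p` and `q`.
  cut : (L : ℚ → Set) → (∀ {p q} → p ℚ.< q → L q → L p) → ∃[ q ] L q → ∃[ q ] ¬ L q → ℝ
  cut L closed (l , Ll) (u , ¬Lu) = record
    { lower           = λ q → ∃[ q′ ] (q ℚ.< q′ × L q′)
    ; upper           = λ q → ∃[ q′ ] (q′ ℚ.< q × ¬ L q′)
    ; lower-inhabited = proj₁ (lower-inhabited (fromℚ l)) , l , proj₂ (lower-inhabited (fromℚ l)) , Ll
    ; upper-inhabited = proj₁ (upper-inhabited (fromℚ u)) , u , proj₂ (upper-inhabited (fromℚ u)) , ¬Lu
    ; lower-closed    = λ p<q (q′ , q<q′ , Lq′) → q′ , ℚₚ.<-trans p<q q<q′ , Lq′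
    ; upper-closed    = λ p<q (p′ , p′<p , ¬Lp′) → p′ , ℚₚ.<-trans p′<p p<q , ¬Lp′
    ; lower-rounded   = λ (q′ , q<q′ , Lq′) →
        let (m , q<m , m<q′) = ℚₚ.<-dense q<q′ in m , q<m , q′ , m<q′ , Lq′
    ; upper-rounded   = λ (q′ , q′<q , ¬Lq′) →
        let (m , q′<m , m<q) = ℚₚ.<-dense q′<q in m , m<q , q′ , q′<m , ¬Lq′
    ; disjoint        = λ ((l′ , q<l′ , Ll′) , (u′ , u′<q , ¬Lu′)) → ¬Lu′ (closed (ℚₚ.<-trans u′<q q<l′) Ll′)
    ; located         = λ p<q → decide (ℚₚ.<-dense p<q)
    }
    where
    decide : ∀ {p q} → ∃[ m ] (p ℚ.< m × m ℚ.< q) →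
      ∃[ p′ ] (p ℚ.< p′ × L p′) ⊎ ∃[ q′ ] (q′ ℚ.< q × ¬ L q′)
    decide (m , p<m , m<q) with em₀ (L m)
    ... | yes Lm = inj₁ (m , p<m , Lm)
    ... | no ¬Lm = inj₂ (m , m<q , ¬Lm)

  infimum : (a : ℕ → ℝ) → ∃[ q ] (∀ k → lower (a k) q) → Σ[ x ∈ ℝ ] IsInfimum a x
  infimum a below = x , (λ k q (q′ , q<q′ , l) → lower-closed (a k) q<q′ (l k)) ,
      λ y y≤a q lq → let (q′ , q<q′ , lq′) = lower-rounded y lq in q′ , q<q′ , λ k → y≤a k q′ lq′
    where
    x = cut (λ q → ∀ k → lower (a k) q) (λ p<q l k → lower-closed (a k) p<q (l k)) below
      (let (q , u) = upper-inhabited (a 0) in q , λ l → disjoint (a 0) (l 0 , u))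

  supremum : (a : ℕ → ℝ) → ∃[ q ] (∀ k → upper (a k) q) → Σ[ x ∈ ℝ ] IsSupremum a x
  supremum a (u , above) = x ,
      (λ k q lq → let (q′ , q<q′ , lq′) = lower-rounded (a k) lq in q′ , q<q′ , k , lq′) ,
      λ y a≤y q (q′ , q<q′ , k , l) → lower-closed y q<q′ (a≤y k q′ l)
    where
    x = cut (λ q → ∃[ k ] lower (a k) q) (λ p<q (k , l) → k , lower-closed (a k) p<q l)
      (let (q , l) = lower-inhabited (a 0) in q , 0 , l)
      (u , λ (k , l) → disjoint (a k) (l , above k))

  liminf : (a : ℕ → ℝ) → ∃[ q ] (∀ k → lower (a k) q) → ∃[ q ] (∀ k → upper (a k) q) →
    Σ[ x ∈ ℝ ] IsLiminf a x
  liminf a (l , below) (u , above) = let (x , sup) = supremum m (u , m-above) in x , m , inf , sup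
    where
    infimum-from : ∀ n → Σ[ y ∈ ℝ ] IsInfimum (λ k → a (n ℕ.+ k)) y
    infimum-from n = infimum (λ k → a (n ℕ.+ k)) (l , λ k → below (n ℕ.+ k))
    m : ℕ → ℝ
    m n = proj₁ (infimum-from n)
    inf : ∀ n → IsInfimum (λ k → a (n ℕ.+ k)) (m n)
    inf n = proj₂ (infimum-from n)
    m-above : ∀ n → upper (m n) u
    m-above n = ≤-upper {m n} {a (n ℕ.+ 0)} (proj₁ (inf n) 0) (above (n ℕ.+ 0))

  -- For Eve to win a play, its mean-payoff has to be exhibited as a real number. It exists because
  -- all averages lie in [-M , M].
  bounded⇒liminf : ∀ (W : ℕ → ℤ) M → (∀ k → ∣ W k ∣ ℕ.≤ M ℕ.* k) → Σ[ x ∈ ℝ ] Liminf W x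
  bounded⇒liminf W M W≤M = liminf (λ k → fromℚ (Average W k))
    (let (q , q<) = lower-inhabited (fromℚ (fromℤ (- (+ M)))) in q , λ k →
      ℚₚ.<-≤-trans q< (≼⇒≤/ {W = W (suc k)} (≼⁺ (≤-by-difference _
        (0≤+ (0≤gap (W≤M′ (suc k))) (0≤i+∣i∣ (W (suc k)))) (identity₁ (+ M) (+ suc k) (W (suc k)) _)))))
    (let (q , <q) = upper-inhabited (fromℚ (fromℤ (+ M))) in q , λ k →
      ℚₚ.≤-<-trans (neg-≼⇒/≤ {W = W (suc k)} (neg-≼⁺ (fromℤ (+ M)) (≤-by-difference _
        (0≤+ (0≤gap (W≤M′ (suc k))) (0≤gap (i≤+∣i∣ (W (suc k))))) (identity₂ (+ M) (+ suc k) (W (suc k)) _)))) <q)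
    where
    W≤M′ : ∀ k → + ∣ W k ∣ ℤ.≤ + M * + k
    W≤M′ k = subst (+ ∣ W k ∣ ℤ.≤_) (ℤₚ.pos-* M k) (ℤ.+≤+ (W≤M k))
    identity₁ : ∀ M k W A → 1ℤ * W - (- M) * k ≡ (M * k - A) + (W + A)
    identity₁ = solve-∀
    identity₂ : ∀ M k W A → M * k - 1ℤ * W ≡ (M * k - A) + (A - W)
    identity₂ = solve-∀

-- Walks and cycle means

infixr 5 _∷_

data Walk {V : Set} (R : V → V → ℤ → Set) : V → V → ℕ → ℤ → Set where
  []  : ∀ {u} → Walk R u u 0 0ℤ
  _∷_ : ∀ {u v x z k W} → R u v z → Walk R v x k W → Walk R u x (suc k) (z + W)

Reaches : {V : Set} → (V → V → ℤ → Set) → V → V → Set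
Reaches R u v = ∃[ k ] ∃[ W ] Walk R u v k W

map-neg : ∀ {V : Set} {R R′ : V → V → ℤ → Set} → (∀ {u v z} → R u v z → R′ u v (- z)) →
  ∀ {u v k W} → Walk R u v k W → Walk R′ u v k (- W)
map-neg f []                          = []
map-neg f (_∷_ {z = z} {W = W} e γ) = subst (Walk _ _ _ _) (sym (ℤₚ.neg-distrib-+ z W)) (f e ∷ map-neg f γ)

module _ {V : Set} {R : V → V → ℤ → Set} where

  infixr 5 _++_

  _++_ : ∀ {u v x k k′ W W′} → Walk R u v k W → Walk R v x k′ W′ → Walk R u x (k ℕ.+ k′) (W + W′)
  _++_ {W′ = W′} []                          γ′ = subst (Walk R _ _ _) (sym (ℤₚ.+-identityˡ W′)) γ′
  _++_ {W′ = W′} (_∷_ {z = z} {W = W} e γ) γ′ = subst (Walk R _ _ _) (sym (ℤₚ.+-assoc z W W′)) (e ∷ (γ ++ γ′))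

  snoc : ∀ {u v x k z W} → Walk R u v k W → R v x z → Walk R u x (suc k) (W + z)
  snoc {z = z} []                         e = subst (Walk R _ _ _) (ℤₚ.+-comm z 0ℤ) (e ∷ [])
  snoc {z = z} (_∷_ {z = z′} {W = W} e′ γ) e = subst (Walk R _ _ _) (sym (ℤₚ.+-assoc z′ W z)) (e′ ∷ snoc γ e)

  repeat : ∀ {u k W} j → Walk R u u k W → Walk R u u (j ℕ.* k) (+ j * W)
  repeat {W = W} zero    γ = subst (Walk R _ _ _) (sym (ℤₚ.*-zeroˡ W)) []
  repeat {W = W} (suc j) γ = subst (Walk R _ _ _) (sym (ℤₚ.suc-* (+ j) W)) (γ ++ repeat j γ)

  weight-bound : ∀ {M} → (∀ {u v z} → R u v z → ∣ z ∣ ℕ.≤ M) →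
    ∀ {u v k W} → Walk R u v k W → ∣ W ∣ ℕ.≤ M ℕ.* k
  weight-bound {M} z≤M []                        = ℕ.z≤n
  weight-bound {M} z≤M (_∷_ {z = z} {k = k} {W} e γ) = ℕₚ.≤-trans (ℤₚ.∣i+j∣≤∣i∣+∣j∣ z W)
    (subst (∣ z ∣ ℕ.+ ∣ W ∣ ℕ.≤_) (sym (ℕₚ.*-suc M k)) (ℕₚ.+-mono-≤ (z≤M e) (weight-bound z≤M γ)))

  reaches-trans : ∀ {u v x} → Reaches R u v → Reaches R v x → Reaches R u x
  reaches-trans (_ , _ , γ) (_ , _ , γ′) = _ , _ , γ ++ γ′

  vertex-at : ∀ {u v k W} → Walk R u v k W → Fin (suc k) → V
  vertex-at {u} γ       Fin.zero    = u
  vertex-at     (e ∷ γ) (Fin.suc i) = vertex-at γ i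

  record Splitting (u v : V) (m k : ℕ) (W : ℤ) (x : V) : Set where
    field
      {k₁ k₂} : ℕ
      {W₁ W₂} : ℤ
      before  : Walk R u x k₁ W₁
      after   : Walk R x v k₂ W₂
      k₁≡     : k₁ ≡ m
      k-sum   : k₁ ℕ.+ k₂ ≡ k
      W-sum   : W₁ + W₂ ≡ W

  split-at : ∀ {u v k W} (γ : Walk R u v k W) i → Splitting u v (toℕ i) k W (vertex-at γ i)
  split-at {W = W} γ Fin.zero = record
    { before = [] ; after = γ ; k₁≡ = refl ; k-sum = refl ; W-sum = ℤₚ.+-identityˡ W }
  split-at (_∷_ {z = z} e γ) (Fin.suc i) = record
    { before = e ∷ before ; after = after ; k₁≡ = cong suc k₁≡ ; k-sum = cong suc k-sum
    ; W-sum = trans (ℤₚ.+-assoc z _ _) (cong (_+_ z) W-sum) }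
    where open Splitting (split-at γ i)

  -- The fields `to` and `from` place the base of the loop on a way from `u` to `v`. A loop cut out
  -- of a closed walk thus stays in the same strongly connected component.
  record Excision (u v : V) (m k : ℕ) (W : ℤ) : Set where
    field
      {x}      : V
      {l k′}   : ℕ
      {Wˡ W′}  : ℤ
      to       : Reaches R u x
      from     : Reaches R x v
      loop     : Walk R x x (suc l) Wˡ
      rest     : Walk R u v k′ W′
      l≤m      : suc l ℕ.≤ m
      k-sum    : suc l ℕ.+ k′ ≡ k
      W-sum    : Wˡ + W′ ≡ W

  excise : ∀ {u v k W} (γ : Walk R u v k W) {i j} → i Fin.< j → vertex-at γ i ≡ vertex-at γ j →
    Excision u v (toℕ j) k W
  excise {u} {v} {k} {W} γ {Fin.zero} {Fin.suc j} _ eq = aux (split-at γ (Fin.suc j)) (sym eq)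
    where
    aux : ∀ {x} → Splitting u v (suc (toℕ j)) k W x → x ≡ u → Excision u v (suc (toℕ j)) k W
    aux record { before = before ; after = after ; k₁≡ = refl ; k-sum = k-sum ; W-sum = W-sum } refl = record
      { to = _ , _ , [] ; from = _ , _ , after ; loop = before ; rest = after
      ; l≤m = ℕₚ.≤-refl ; k-sum = k-sum ; W-sum = W-sum }
  excise (_∷_ {z = z} e γ) {Fin.suc i} {Fin.suc j} (ℕ.s≤s i<j) eq = record
    { to = reaches-trans (_ , _ , e ∷ []) to ; from = from ; loop = loop ; rest = e ∷ rest
    ; l≤m = ℕₚ.m≤n⇒m≤1+n l≤m
    ; k-sum = trans (ℕₚ.+-suc (suc l) k′) (cong suc k-sum)
    ; W-sum = trans (identity Wˡ z W′) (cong (_+_ z) W-sum) }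
    where
    open Excision (excise γ i<j eq)
    identity : ∀ a b c → a + (b + c) ≡ b + (a + c)
    identity = solve-∀

-- The pigeonhole principle is applied to the first `n + 1` vertices only, which keeps the loop no
-- longer than `n`.
excise-long : ∀ {n R} {u v : Fin n} {k W} → Walk R u v k W → n ℕ.< k → Excision u v n k W
excise-long {n} γ n<k with Finₚ.pigeonhole (ℕₚ.n<1+n n) (λ i → vertex-at γ (inject≤ i (ℕ.s≤s (ℕₚ.<⇒≤ n<k))))
... | i , j , i<j , eq = record
  { Excision found
  ; l≤m = ℕₚ.≤-trans (Excision.l≤m found) (subst (ℕ._≤ n) (sym (Finₚ.toℕ-inject≤ j _)) (Finₚ.toℕ≤pred[n] j)) }
  where
  found = excise γ (subst₂ ℕ._<_ (sym (Finₚ.toℕ-inject≤ i _)) (sym (Finₚ.toℕ-inject≤ j _)) i<j) eq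

/-mono-≤ : ∀ {W W′ l l′} → W * + suc l′ ℤ.≤ W′ * + suc l → W ℚ./ suc l ℚ.≤ W′ ℚ./ suc l′
/-mono-≤ {W} {W′} {l} {l′} h = ℚₚ.toℚᵘ-cancel-≤
  (ℚᵘₚ.≤-respˡ-≃ (ℚᵘₚ.≃-sym (ℚₚ.toℚᵘ-fromℚᵘ (ℚᵘ.mkℚᵘ W l)))
    (ℚᵘₚ.≤-respʳ-≃ (ℚᵘₚ.≃-sym (ℚₚ.toℚᵘ-fromℚᵘ (ℚᵘ.mkℚᵘ W′ l′))) (ℚᵘ.*≤* h)))

bound-exists : ∀ {L p} → (∀ {r} → L r → r ℚ.< p) → ∀ k W → Bound L (∣ ↥ p ∣ ℕ.* k ℕ.+ ∣ W ∣) k W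
bound-exists {L} {p} L<p = bound-crude ∣ ↥ p ∣ λ {r} Lr → ℤₚ.0≤i-j⇒j≤i (cancel-0≤ (↧ p) (subst (0ℤ ℤ.≤_)
  (identity (↥ r) (↧ r) (↥ p) (↧ p) (+ ∣ ↥ p ∣))
  (0≤+ (0≤+ (0≤gap (ℤₚ.<⇒≤ (ℚₚ.drop-*<* (L<p Lr)))) (0≤* (0≤gap (i≤+∣i∣ (↥ p))) (0≤↧ r)))
    (0≤* (0≤* (0≤gap (1≤↧ p)) 0≤+n) (0≤↧ r)))))
  where
  identity : ∀ n d n′ d′ A → (n′ * d - n * d′) + (A - n′) * d + (d′ - 1ℤ) * A * d ≡ d′ * (d * A - n)
  identity = solve-∀

-- Minimal cycle means and recurrence

module Cycles (em : ExcludedMiddle (lsuc 0ℓ)) where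
  open Classical em

  least : ∀ {P : ℤ → Set} B → (∀ {z} → P z → - (+ B) ℤ.≤ z) → ∃[ z ] P z →
    ∃[ z ] (P z × (∀ {z′} → P z′ → z ℤ.≤ z′))
  -- Fuel for the search: every improvement lowers the value by at least 1, and no value lies below
  -- `-B`.
  least {P} B B≤ (z₀ , Pz₀) = search ∣ z₀ + + B ∣ Pz₀
    (subst (ℤ._≤ - (+ B) + + ∣ z₀ + + B ∣) (identity z₀ (+ B)) (ℤₚ.+-monoʳ-≤ (- (+ B)) (i≤+∣i∣ (z₀ + + B))))
    where
    identity : ∀ z B → - B + (z + B) ≡ z
    identity = solve-∀
    search : ∀ f {z} → P z → z ℤ.≤ - (+ B) + + f → ∃[ z ] (P z × (∀ {z′} → P z′ → z ℤ.≤ z′))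
    search zero    {z} Pz z≤ = z , Pz , λ Pz′ →
      ℤₚ.≤-trans z≤ (subst (ℤ._≤ _) (sym (ℤₚ.+-identityʳ (- (+ B)))) (B≤ Pz′))
    search (suc f) {z} Pz z≤ with em₀ (∃[ z′ ] (P z′ × z′ ℤ.< z))
    ... | no  ∄     = z , Pz , λ {z′} Pz′ → ℤₚ.≮⇒≥ λ z′<z → ∄ (z′ , Pz′ , z′<z)
    ... | yes (z′ , Pz′ , z′<z) = search f Pz′
      (≤-by-difference _ (0≤+ (0≤gap z≤) (0≤gap-< z′<z)) (step (+ B) (+ f) z z′))
      where
      step : ∀ B f z z′ → - B + f - z′ ≡ (- B + (1ℤ + f) - z) + (z - (1ℤ + z′))
      step = solve-∀

  below-suc : ∀ {P : ℕ → Set} {m} → (∀ {l} → l ℕ.< m → P l) → P m → ∀ {l} → l ℕ.< suc m → P l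
  below-suc below Pm l<1+m with ℕₚ.m≤n⇒m<n∨m≡n (ℕ.s≤s⁻¹ l<1+m)
  ... | inj₁ l<m  = below l<m
  ... | inj₂ refl = Pm

  -- `Q l W` stands for the existence of a closed walk of length `l` and weight `W` in a fixed
  -- component. Only finitely many lengths have to be compared, since long closed walks split into
  -- shorter ones.
  module MinimalMean {Q : ℕ → ℤ → Set} (M : ℕ) (bounded : ∀ {l W} → Q l W → ∣ W ∣ ℕ.≤ M ℕ.* l) where

    Mean : ℚ → Set
    Mean μ = ∃[ l ] ∃[ W ] (Q (suc l) W × μ ≡ W ℚ./ suc l)

    infix 4 _≤means-of_
    _≤means-of_ : ℚ → ℕ → Set
    μ ≤means-of l = ∀ W → Q (suc l) W → μ ℚ.≤ W ℚ./ suc l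

    least-of-length : ∀ l → (∀ W → ¬ Q (suc l) W) ⊎ ∃[ μ ] (Mean μ × μ ≤means-of l)
    least-of-length l with em₀ (∃[ W ] Q (suc l) W)
    ... | no ∄     = inj₁ λ W q → ∄ (W , q)
    ... | yes some = inj₂ (least-mean (least (M ℕ.* suc l) lower-bound some))
      where
      identity : ∀ z B A → z - (- B) ≡ (B - A) + (z + A)
      identity = solve-∀

      lower-bound : ∀ {z} → Q (suc l) z → - (+ (M ℕ.* suc l)) ℤ.≤ z
      lower-bound {z} q = ≤-by-difference _ (0≤+ (0≤gap (ℤ.+≤+ (bounded q))) (0≤i+∣i∣ z))
        (identity z (+ (M ℕ.* suc l)) (+ ∣ z ∣))

      least-mean : ∃[ W ] (Q (suc l) W × (∀ {W′} → Q (suc l) W′ → W ℤ.≤ W′)) → ∃[ μ ] (Mean μ × μ ≤means-of l)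
      least-mean (W , q , W≤) = W ℚ./ suc l , (l , W , q , refl) ,
        λ W′ q′ → /-mono-≤ {W} {W′} {l} {l} (ℤₚ.*-monoʳ-≤-nonNeg (+ suc l) (W≤ q′))

    least-below : ∀ m → (∀ {l} → l ℕ.< m → ∀ W → ¬ Q (suc l) W) ⊎
      ∃[ μ ] (Mean μ × (∀ {l} → l ℕ.< m → μ ≤means-of l))
    least-below zero    = inj₁ λ ()
    least-below (suc m) with least-below m | least-of-length m
    ... | inj₁ none | inj₁ none′ = inj₁ (below-suc none none′)
    ... | inj₁ none | inj₂ (μ , mean , μ≤) =
      inj₂ (μ , mean , below-suc (λ l<m W q → contradiction q (none l<m W)) μ≤)
    ... | inj₂ (μ , mean , μ≤) | inj₁ none =
      inj₂ (μ , mean , below-suc μ≤ (λ W q → contradiction q (none W)))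
    ... | inj₂ (μ , mean , μ≤) | inj₂ (μ′ , mean′ , μ′≤) with ℚₚ.≤-total μ μ′
    ...   | inj₁ μ≤μ′ = inj₂ (μ , mean , below-suc μ≤ (λ W q → ℚₚ.≤-trans μ≤μ′ (μ′≤ W q)))
    ...   | inj₂ μ′≤μ = inj₂ (μ′ , mean′ , below-suc (λ l<m W q → ℚₚ.≤-trans μ′≤μ (μ≤ l<m W q)) μ′≤)

    module _ (n : ℕ)
      (trivial : ∀ {W} → Q 0 W → W ≡ 0ℤ)
      (splits : ∀ {l W} → Q l W → n ℕ.< l → ∃[ l₁ ] ∃[ W₁ ] ∃[ l₂ ] ∃[ W₂ ]
        (Q (suc l₁) W₁ × Q l₂ W₂ × suc l₁ ℕ.≤ n × suc l₁ ℕ.+ l₂ ≡ l × W₁ + W₂ ≡ W)) where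

      -- Strong induction on the length: a long closed walk splits into a part of length at most
      -- `n`, whose mean has been compared with `μ`, and a shorter rest. The two inequalities add
      -- up.
      ≼-all : ∀ {μ} → (∀ {l} → l ℕ.< n → μ ≤means-of l) → ∀ {l W} → Q l W → μ · l ≼ W
      ≼-all {μ} μ≤ {l} = <-rec (λ l → ∀ {W} → Q l W → μ · l ≼ W) step l
        where
        step : ∀ l → (∀ {l′} → l′ ℕ.< l → ∀ {W} → Q l′ W → μ · l′ ≼ W) → ∀ {W} → Q l W → μ · l ≼ W
        step zero    rec q = subst (μ · 0 ≼_) (sym (trivial q)) ≼-zero
        step (suc l) rec q with suc l ℕₚ.≤? n
        ... | yes l<n = ≤/⇒≼ (μ≤ l<n _ q)
        ... | no  l≮n with splits q (ℕₚ.≰⇒> l≮n)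
        ...   | l₁ , W₁ , l₂ , W₂ , q₁ , q₂ , l₁<n , l-sum , refl =
          subst (μ ·_≼ W₁ + W₂) l-sum (≼-+ {W = W₁} (≤/⇒≼ (μ≤ l₁<n W₁ q₁))
            (rec (subst (l₂ ℕ.<_) l-sum (ℕ.s≤s (ℕₚ.m≤n+m l₂ l₁))) q₂))

      minimal-mean : ∃[ l ] ∃[ W ] Q (suc l) W → ∃[ μ ] (Mean μ × (∀ {l W} → Q l W → μ · l ≼ W))
      minimal-mean (l , W , q) with least-below n
      ... | inj₂ (μ , mean , μ≤) = μ , mean , ≼-all μ≤
      ... | inj₁ none with suc l ℕₚ.≤? n
      ...   | yes l<n = contradiction q (none l<n _)
      ...   | no  l≮n = let (_ , _ , _ , _ , q₁ , _ , l₁<n , _) = splits q (ℕₚ.≰⇒> l≮n) in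
        contradiction q₁ (none l₁<n _)

  module _ {n} {R : Fin n → Fin n → ℤ → Set} where

    -- The cycle of least mean lies in the strongly connected component of `v` but may avoid `v`
    -- itself, hence the separate base `u`.
    record MinimalCycle (v : Fin n) : Set where
      field
        {u}     : Fin n
        {l}     : ℕ
        {W}     : ℤ
        {mean}  : ℚ
        to      : Reaches R v u
        from    : Reaches R u v
        cycle   : Walk R u u (suc l) W
        mean≡   : mean ≡ W ℚ./ suc l
        minimal : ∀ {k W} → Walk R v v k W → mean · k ≼ W

    minimal-cycle : ∀ M → (∀ {u v z} → R u v z → ∣ z ∣ ℕ.≤ M) →
      ∀ {v} → ∃[ l ] ∃[ W ] Walk R v v (suc l) W → MinimalCycle v
    minimal-cycle M z≤M {v} (l₀ , W₀ , γ₀) = build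
      (minimal-mean n (λ (_ , _ , _ , γ) → trivial γ) splits (l₀ , W₀ , v , (_ , _ , []) , (_ , _ , []) , γ₀))
      where
      -- The base ranges over the whole component, because a loop excised from a closed walk at `v`
      -- need not pass through `v`.
      Closed : ℕ → ℤ → Set
      Closed l W = ∃[ u ] (Reaches R v u × Reaches R u v × Walk R u u l W)

      open MinimalMean {Closed} M (λ (_ , _ , _ , γ) → weight-bound z≤M γ)

      trivial : ∀ {u u′ W} → Walk R u u′ 0 W → W ≡ 0ℤ
      trivial [] = refl

      splits : ∀ {l W} → Closed l W → n ℕ.< l → ∃[ l₁ ] ∃[ W₁ ] ∃[ l₂ ] ∃[ W₂ ]
        (Closed (suc l₁) W₁ × Closed l₂ W₂ × suc l₁ ℕ.≤ n × suc l₁ ℕ.+ l₂ ≡ l × W₁ + W₂ ≡ W)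
      splits (u , v⇝u , u⇝v , γ) n<l = _ , _ , _ , _ ,
        (x , reaches-trans v⇝u to , reaches-trans from u⇝v , loop) , (u , v⇝u , u⇝v , rest) , l≤m , k-sum , W-sum
        where open Excision (excise-long γ n<l)

      build : ∃[ μ ] (Mean μ × (∀ {l W} → Closed l W → μ · l ≼ W)) → MinimalCycle v
      build (μ , (l , W , (u , to , from , γ) , μ≡) , min) = record
        { to = to ; from = from ; cycle = γ ; mean≡ = μ≡
        ; minimal = λ γ′ → min (v , (_ , _ , []) , (_ , _ , []) , γ′) }

    -- A walk that can be closed up loses at most what the closing walk gains.
    walk-bound : ∀ {v μ} → (∀ {k W} → Walk R v v k W → μ · k ≼ W) →
      ∃[ C ] (∀ u {k W} → Reaches R u v → Walk R v u k W → Bound (ℚ._< μ) C k W)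
    walk-bound {v} {μ} min = proj₁ uniform , λ u → proj₂ uniform u
      where
      Bounded : Fin n → ℕ → Set
      Bounded u C = ∀ {k W} → Reaches R u v → Walk R v u k W → Bound (ℚ._< μ) C k W

      each : ∀ u → ∃[ C ] Bounded u C
      each u with em₀ (Reaches R u v)
      ... | no  u⇝̸v = 0 , λ u⇝v → contradiction u⇝v u⇝̸v
      ... | yes (k₀ , W₀ , γ₀) = _ , λ {k} {W} _ γ →
        bound-cancel (proj₂ (lower-inhabited (fromℚ μ))) {C = 0} k₀ W₀ (bound λ {r} r<μ →
          ≼-mono (ℚₚ.<⇒≤ r<μ) (subst₂ (μ ·_≼_) (ℕₚ.+-comm k k₀)
            (trans (ℤₚ.+-comm W W₀) (sym (ℤₚ.+-identityʳ (W₀ + W)))) (min (γ ++ γ₀))))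

      uniform = finite-max {P = Bounded} (λ u c≤c′ b u⇝v γ → bound-weaken c≤c′ (b u⇝v γ)) each

    module _ (ρ : ℕ → Fin n) (S : ℕ → ℤ)
             (step : ∀ t → ∃[ z ] (R (ρ t) (ρ (suc t)) z × S (suc t) ≡ S t + z)) where

      segment : ∀ i j → ∃[ W ] (Walk R (ρ i) (ρ (j ℕ.+ i)) j W × S (j ℕ.+ i) ≡ S i + W)
      segment i zero    = 0ℤ , [] , sym (ℤₚ.+-identityʳ (S i))
      segment i (suc j) with segment i j | step (j ℕ.+ i)
      ... | W , γ , eq | z , e , eq′ =
        W + z , snoc γ e , trans eq′ (trans (cong (_+ z) eq) (ℤₚ.+-assoc (S i) W z))

      path : ∀ {i j} → i ℕ.≤ j → Reaches R (ρ i) (ρ j)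
      path {i} {j} i≤j with segment i (j ℕ.∸ i)
      ... | W , γ , _ = _ , _ , subst (λ t → Walk R (ρ i) (ρ t) (j ℕ.∸ i) W) (ℕₚ.m∸n+n≡m i≤j) γ

      -- The first `N` steps contribute a constant. From then on the play is a walk from `ρ N` that
      -- can always be closed up, so `walk-bound` applies.
      tail-bound : ∀ {μ} N → (∀ {k W} → Walk R (ρ N) (ρ N) k W → μ · k ≼ W) →
        (∀ i → N ℕ.≤ i → Reaches R (ρ i) (ρ N)) →
        ∃[ C ] (∀ j → N ℕ.≤ j → Bound (ℚ._< μ) C j (S j))
      tail-bound {μ} N min back = _ , λ j N≤j → let (W , γ , eq) = segment N (j ℕ.∸ N) in
        subst₂ (Bound (ℚ._< μ) _) (ℕₚ.m+[n∸m]≡n N≤j) (trans (sym eq) (cong S (ℕₚ.m∸n+n≡m N≤j)))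
          (bound-+ (bound-exists (λ r<μ → r<μ) N (S N))
            (proj₂ (walk-bound min) (ρ (j ℕ.∸ N ℕ.+ N)) (back _ (ℕₚ.m≤n+m N (j ℕ.∸ N))) γ))

  -- Each vertex is either avoided from some time on or visited again and again; `N` is the maximum
  -- of these times over the finitely many vertices.
  recurrent : ∀ {n} (ρ : ℕ → Fin n) → ∃[ N ] (∀ i → N ℕ.≤ i → ∀ j → ∃[ t ] (j ℕ.≤ t × ρ t ≡ ρ i))
  recurrent {n} ρ = proj₁ uniform , λ i N≤i → eventually (proj₂ uniform (ρ i)) N≤i
    where
    Settled : Fin n → ℕ → Set
    Settled u N = (∀ t → N ℕ.≤ t → ρ t ≢ u) ⊎ (∀ j → ∃[ t ] (j ℕ.≤ t × ρ t ≡ u))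

    each : ∀ u → ∃[ N ] Settled u N
    each u with em₀ (∃[ N ] (∀ t → N ℕ.≤ t → ρ t ≢ u))
    ... | yes (N , never) = N , inj₁ never
    ... | no  ∄           = 0 , inj₂ again
      where
      again : ∀ j → ∃[ t ] (j ℕ.≤ t × ρ t ≡ u)
      again j with em₀ (∃[ t ] (j ℕ.≤ t × ρ t ≡ u))
      ... | yes found = found
      ... | no  none  = contradiction (j , λ t j≤t eq → none (t , j≤t , eq)) ∄

    settled-mono : ∀ u {N N′} → N ℕ.≤ N′ → Settled u N → Settled u N′
    settled-mono u N≤N′ (inj₁ never) = inj₁ λ t N′≤t → never t (ℕₚ.≤-trans N≤N′ N′≤t)
    settled-mono u N≤N′ (inj₂ again) = inj₂ again

    uniform = finite-max settled-mono each

    eventually : ∀ {i N} → Settled (ρ i) N → N ℕ.≤ i → ∀ j → ∃[ t ] (j ℕ.≤ t × ρ t ≡ ρ i)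
    eventually {i} (inj₁ never) N≤i = contradiction refl (never i N≤i)
    eventually     (inj₂ again) _   = again

module _ {V : Set} {R : V → V → ℤ → Set} where

  positive : ∀ {u k W} → 0 ℕ.< k → Walk R u u k W → ∃[ l ] (k ≡ suc l × Walk R u u (suc l) W)
  positive (ℕ.s≤s _) γ = _ , refl , γ

  -- Repeating the cycle often enough outweighs the detour through it.
  detour-below : ∀ {r v u k₁ k₂ l W₁ W₂ W} → ↧ r * W ℤ.< ↥ r * + suc l →
    Walk R v u k₁ W₁ → Walk R u u (suc l) W → Walk R u v k₂ W₂ →
    ∃[ l′ ] ∃[ W′ ] (Walk R v v (suc l′) W′ × ↧ r * W′ ℤ.≤ ↥ r * + suc l′)
  detour-below {r} {v} {u} {k₁} {k₂} {l} {W₁} {W₂} {W} W<r γ₁ γ γ₂ =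
    finish (positive pos (γ₁ ++ (repeat j γ ++ γ₂)))
    where
    D = ↧ r * (W₁ + W₂) - ↥ r * (+ k₁ + + k₂)
    j = suc ∣ D ∣
    k = k₁ ℕ.+ (j ℕ.* suc l ℕ.+ k₂)

    pos : 0 ℕ.< k
    pos = ℕₚ.≤-trans (ℕ.s≤s ℕ.z≤n) (ℕₚ.m≤n+m _ k₁)

    identity : ∀ n d k₁ k₂ l W₁ W₂ W j →
      n * (k₁ + (j * l + k₂)) - d * (W₁ + (j * W + W₂)) ≡
      j * (n * l - (1ℤ + d * W)) + (j - (d * (W₁ + W₂) - n * (k₁ + k₂)))
    identity = solve-∀

    W′≤ : ↧ r * (W₁ + (+ j * W + W₂)) ℤ.≤ ↥ r * + k
    W′≤ = ≤-by-difference _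
      (0≤+ (0≤* (0≤+n {j}) (0≤gap-< W<r)) (0≤gap (ℤₚ.≤-trans (i≤+∣i∣ D) (ℤ.+≤+ (ℕₚ.n≤1+n _)))))
      (trans (cong (λ y → ↥ r * (+ k₁ + (y + + k₂)) - ↧ r * (W₁ + (+ j * W + W₂))) (ℤₚ.pos-* j (suc l)))
        (identity (↥ r) (↧ r) (+ k₁) (+ k₂) (+ suc l) W₁ W₂ W (+ j)))

    finish : ∃[ l′ ] (k ≡ suc l′ × Walk R v v (suc l′) (W₁ + (+ j * W + W₂))) →
      ∃[ l′ ] ∃[ W′ ] (Walk R v v (suc l′) W′ × ↧ r * W′ ℤ.≤ ↥ r * + suc l′)
    finish (l′ , k≡ , γ′) = l′ , _ , γ′ , subst (λ k → ↧ r * (W₁ + (+ j * W + W₂)) ℤ.≤ ↥ r * + k) k≡ W′≤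

  -- The cycles deviate from c by -α and β, so β copies of the first balance α copies of the second.
  balanced-cycle : ∀ {c v a b Wᵃ Wᵇ} → Walk R v v (suc a) Wᵃ → ↧ c * Wᵃ ℤ.≤ ↥ c * + suc a →
    Walk R v v (suc b) Wᵇ → ↥ c * + suc b ℤ.≤ ↧ c * Wᵇ →
    ∃[ l ] ∃[ W ] (Walk R v v (suc l) W × ↧ c * W ≡ ↥ c * + suc l)
  balanced-cycle {c} {v} {a} {b} {Wᵃ} {Wᵇ} γᵃ a≤ γᵇ ≤b = go α refl
    where
    α = ∣ ↥ c * + suc a - ↧ c * Wᵃ ∣
    β = ∣ ↧ c * Wᵇ - ↥ c * + suc b ∣
    +α : + α ≡ ↥ c * + suc a - ↧ c * Wᵃ
    +α = ℤₚ.0≤i⇒+∣i∣≡i (0≤gap a≤)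
    +β : + β ≡ ↧ c * Wᵇ - ↥ c * + suc b
    +β = ℤₚ.0≤i⇒+∣i∣≡i (0≤gap ≤b)

    Goal = ∃[ l ] ∃[ W ] (Walk R v v (suc l) W × ↧ c * W ≡ ↥ c * + suc l)

    identity : ∀ n d a b Wᵃ Wᵇ → d * ((d * Wᵇ - n * b) * Wᵃ + (n * a - d * Wᵃ) * Wᵇ) ≡
      n * ((d * Wᵇ - n * b) * a + (n * a - d * Wᵃ) * b)
    identity = solve-∀

    exact : ↧ c * (+ β * Wᵃ + + α * Wᵇ) ≡ ↥ c * + (β ℕ.* suc a ℕ.+ α ℕ.* suc b)
    exact = trans (subst₂ (λ x y → ↧ c * (y * Wᵃ + x * Wᵇ) ≡ ↥ c * (y * + suc a + x * + suc b)) (sym +α) (sym +β)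
        (identity (↥ c) (↧ c) (+ suc a) (+ suc b) Wᵃ Wᵇ))
      (cong (↥ c *_) (sym (cong₂ _+_ (ℤₚ.pos-* β (suc a)) (ℤₚ.pos-* α (suc b)))))

    go : ∀ α′ → α ≡ α′ → Goal
    go zero    α≡ = a , Wᵃ , γᵃ , sym (ℤₚ.i-j≡0⇒i≡j _ _ (trans (sym +α) (cong +_ α≡)))
    go (suc _) α≡ with positive
                        (ℕₚ.≤-trans (subst (λ x → 0 ℕ.< x ℕ.* suc b) (sym α≡) (ℕ.s≤s ℕ.z≤n))
                          (ℕₚ.m≤n+m _ (β ℕ.* suc a)))
                        (repeat β γᵃ ++ repeat α γᵇ)
    ... | l , k≡ , γ = l , _ , γ , trans exact (cong (λ k → ↥ c * + k) k≡)

-- Plays made of loops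

module Looping {V : Set} {R : V → V → ℤ → Set} (v : V) where

  Loop : Set
  Loop = ∃[ l ] ∃[ W ] Walk R v v (suc l) W

  Cursor : Set
  Cursor = ∃[ u ] ∃[ l ] ∃[ W ] Walk R u v l W

  here : Cursor → V
  here = proj₁

  remaining : Cursor → ℕ
  remaining (_ , l , _) = l

  remaining-weight : Cursor → ℤ
  remaining-weight (_ , _ , W , _) = W

  home : Cursor
  home = v , 0 , 0ℤ , []

  advance : Loop → Cursor → Cursor
  advance _             (_ , _ , _ , _ ∷ γ) = _ , _ , _ , γ
  advance (_ , _ , _ ∷ γ) (_ , _ , _ , [])    = _ , _ , _ , γ

  gain : Loop → Cursor → ℤ
  gain _               (_ , _ , _ , _∷_ {z = z} _ _) = z
  gain (_ , _ , _∷_ {z = z} _ _) (_ , _ , _ , [])    = z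

  advance-edge : ∀ L c → R (here c) (here (advance L c)) (gain L c)
  advance-edge _             (_ , _ , _ , e ∷ _) = e
  advance-edge (_ , _ , e ∷ _) (_ , _ , _ , [])    = e

  module _ (choose : ℕ → ℤ → Loop) (c₀ : Cursor) where

    cursor : ℕ → Cursor
    gained  : ℕ → ℤ
    cursor zero    = c₀
    cursor (suc t) = advance (choose t (gained t)) (cursor t)
    gained zero    = 0ℤ
    gained (suc t) = gained t + gain (choose t (gained t)) (cursor t)

    looping-step : ∀ t → ∃[ z ] (R (here (cursor t)) (here (cursor (suc t))) z × gained (suc t) ≡ gained t + z)
    looping-step t = _ , advance-edge (choose t (gained t)) (cursor t) , refl

    module _ (Inv : ℕ → ℤ → Set) (m : ℕ)
             (Inv₀ : Inv (remaining c₀) (remaining-weight c₀)) (c₀≤m : remaining c₀ ℕ.≤ m)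
             (Inv-step : ∀ k W → Inv k W →
               Inv (k ℕ.+ suc (proj₁ (choose k W))) (W + proj₁ (proj₂ (choose k W))) ×
               suc (proj₁ (choose k W)) ℕ.≤ m) where

      -- `Inv` speaks of the length and weight that the play will have at the end of the walk in
      -- progress. These stay the same along that walk and change only when a new loop is begun at
      -- `v`.
      looping-invariant : ∀ t → Inv (t ℕ.+ remaining (cursor t)) (gained t + remaining-weight (cursor t)) ×
        remaining (cursor t) ℕ.≤ m
      looping-invariant zero    = subst (Inv (remaining c₀)) (sym (ℤₚ.+-identityˡ _)) Inv₀ , c₀≤m
      looping-invariant (suc t) =
        after (choose t (gained t)) (cursor t) (looping-invariant t) (Inv-step t (gained t))
        where
        after : ∀ (L : Loop) (c : Cursor) →
          Inv (t ℕ.+ remaining c) (gained t + remaining-weight c) × remaining c ℕ.≤ m →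
          (Inv t (gained t) → Inv (t ℕ.+ suc (proj₁ L)) (gained t + proj₁ (proj₂ L)) × suc (proj₁ L) ℕ.≤ m) →
          Inv (suc t ℕ.+ remaining (advance L c)) (gained t + gain L c + remaining-weight (advance L c)) ×
            remaining (advance L c) ℕ.≤ m
        after _ (_ , suc l , _ , _∷_ {z = z} {W = W} _ _) (inv , ≤m) _ =
          subst₂ Inv (ℕₚ.+-suc t l) (sym (ℤₚ.+-assoc (gained t) z W)) inv , ℕₚ.<⇒≤ ≤m
        after (l , _ , _∷_ {z = z} {W = W} _ _) (_ , _ , _ , []) (inv , _) next =
          let (inv′ , ≤m) = next (subst₂ Inv (ℕₚ.+-identityʳ t) (ℤₚ.+-identityʳ (gained t)) inv) in
          subst₂ Inv (ℕₚ.+-suc t l) (sym (ℤₚ.+-assoc (gained t) z W)) inv′ , ℕₚ.<⇒≤ ≤m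

  module _ (L : Loop) (c₀ : Cursor) where

    private
      c : ℕ → Cursor
      c = cursor (λ _ _ → L) c₀

    return-home : ∀ m t → remaining (c t) ≡ m → c (m ℕ.+ t) ≡ home
    return-home zero    t eq with c t
    return-home zero    t refl | _ , _ , _ , [] = refl
    return-home (suc m) t eq = subst (λ s → c s ≡ home) (ℕₚ.+-suc m t) (return-home m (suc t) (shorter (c t) eq))
      where
      shorter : ∀ c → remaining c ≡ suc m → remaining (advance L c) ≡ m
      shorter (_ , _ , _ , _ ∷ _) refl = refl

    -- After `p` steps the play is at `v` with nothing left to walk, and again after one more loop,
    -- `d + 1` steps later. As the loop is always the same, equal cursors have equal futures.
    looping-periodic : ∃[ p ] ∃[ d ] (∀ j → here (c (j ℕ.+ (d ℕ.+ suc p))) ≡ here (c (j ℕ.+ p)))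
    looping-periodic = p , l , λ j → cong here (same j)
      where
      l = proj₁ L
      p = remaining c₀ ℕ.+ 0
      at-p : c p ≡ home
      at-p = return-home _ 0 refl
      first : ∀ (L : Loop) → remaining (advance L home) ≡ proj₁ L
      first (_ , _ , _ ∷ _) = refl
      at-N : c (l ℕ.+ suc p) ≡ home
      at-N = return-home l (suc p) (trans (cong (λ x → remaining (advance L x)) at-p) (first L))
      same : ∀ j → c (j ℕ.+ (l ℕ.+ suc p)) ≡ c (j ℕ.+ p)
      same zero    = trans at-N (sym at-p)
      same (suc j) = cong (advance L) (same j)

-- Controllers for Eve

record Within (a b : ℝ) (C k : ℕ) (W : ℤ) : Set where
  constructor _,_
  field
    is-above : Above a C k W
    is-below : Below b C k W

open Within public

below-+ : ∀ b {C C′ k k′ W W′} → Below b C k W → Below b C′ k′ W′ → Below b (C ℕ.+ C′) (k ℕ.+ k′) (W + W′)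
below-+ b {W = W} {W′} h h′ = subst (Bound _ _ _) (sym (ℤₚ.neg-distrib-+ W W′)) (bound-+ h h′)

module _ {a b : ℝ} where

  within-+ : ∀ {C C′ k k′ W W′} → Within a b C k W → Within a b C′ k′ W′ →
    Within a b (C ℕ.+ C′) (k ℕ.+ k′) (W + W′)
  within-+ {W = W} {W′} (h , h′) (g , g′) = bound-+ h g , below-+ b {W = W} {W′} h′ g′

  within-weaken : ∀ {C C′ k W} → C ℕ.≤ C′ → Within a b C k W → Within a b C′ k W
  within-weaken C≤C′ (h , h′) = bound-weaken C≤C′ h , bound-weaken C≤C′ h′

  within-hull : ∀ {a′ b′ C k W} → a′ ≤ a → b ≤ b′ → Within a b C k W → Within a′ b′ C k W
  within-hull {b′ = b′} a′≤a b≤b′ (h , h′) =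
    bound (λ l → bound-at h (a′≤a _ l)) , bound (λ u → bound-at h′ (≤-upper {b} {b′} b≤b′ u))

  within-exists : ∀ k W → ∃[ C ] Within a b C k W
  within-exists k W = Cᵃ ℕ.⊔ Cᵇ ,
    (bound-weaken (ℕₚ.m≤m⊔n Cᵃ Cᵇ) (bound-exists (λ l → lower<upper a l uᵃ) k W) ,
     bound-weaken (ℕₚ.m≤n⊔m Cᵃ Cᵇ) (bound-exists (λ {r} u → subst (ℚ._< ℚ.- lᵇ) (⁻¹-involutive r)
       (ℚₚ.neg-antimono-< (lower<upper b lᵇ-lower u))) k (- W)))
    where
    qᵃ = proj₁ (upper-inhabited a)
    uᵃ = proj₂ (upper-inhabited a)
    lᵇ = proj₁ (lower-inhabited b)
    lᵇ-lower = proj₂ (lower-inhabited b)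
    Cᵃ = ∣ ↥ qᵃ ∣ ℕ.* k ℕ.+ ∣ W ∣
    Cᵇ = ∣ ↥ (ℚ.- lᵇ) ∣ ℕ.* k ℕ.+ ∣ - W ∣

  -- The rate `q` is fixed before everything else: it depends on `a` and `b` alone, so one constant
  -- can cover all dropped pieces of bounded length.
  within-cancel : ∃[ q ] (∀ {C k W} k₀ W₀ → Within a b C (k₀ ℕ.+ k) (W₀ + W) →
    Within a b (C ℕ.+ (q ℕ.* k₀ ℕ.+ ∣ W₀ ∣)) k W)
  within-cancel = n ℕ.⊔ n′ , λ {C} {k} {W} k₀ W₀ (h , h′) →
    bound-weaken (ℕₚ.+-monoʳ-≤ C (ℕₚ.+-monoˡ-≤ ∣ W₀ ∣ (ℕₚ.*-monoˡ-≤ k₀ (ℕₚ.m≤m⊔n n n′))))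
      (bound-cancel l k₀ W₀ h) ,
    bound-weaken (ℕₚ.+-monoʳ-≤ C (ℕₚ.+-mono-≤ (ℕₚ.*-monoˡ-≤ k₀ (ℕₚ.m≤n⊔m n n′)) (ℕₚ.≤-reflexive (ℤₚ.∣-i∣≡∣i∣ W₀))))
      (bound-cancel u k₀ (- W₀) (subst (Bound _ _ _) (ℤₚ.neg-distrib-+ W₀ W) h′))
    where
    n  = ∣ ↥ (proj₁ (lower-inhabited a)) ∣
    l  = proj₂ (lower-inhabited a)
    q  = proj₁ (upper-inhabited b)
    n′ = ∣ ↥ (ℚ.- q) ∣
    u : upper b (ℚ.- (ℚ.- q))
    u = subst (upper b) (sym (⁻¹-involutive q)) (proj₂ (upper-inhabited b))

Finite : Set → Set
Finite S = ∃[ n ] Σ[ encode ∈ (S → Fin n) ] Σ[ decode ∈ (Fin n → S) ] (∀ s → decode (encode s) ≡ s)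

data Mode : Set where
  first second : Mode

finite-Mode : Finite Mode
finite-Mode = 2 , (λ { first → Fin.zero ; second → Fin.suc Fin.zero }) ,
  (λ { Fin.zero → first ; (Fin.suc _) → second }) , λ { first → refl ; second → refl }

finite-Fin : ∀ n → Finite (Fin n)
finite-Fin n = n , (λ i → i) , (λ i → i) , λ _ → refl

finite-× : ∀ {S S′} → Finite S → Finite S′ → Finite (S × S′)
finite-× (n , e , d , de) (n′ , e′ , d′ , de′) = n ℕ.* n′ , (λ (s , s′) → combine (e s) (e′ s′)) ,
  (λ i → let (j , j′) = remQuot n′ i in d j , d′ j′) ,
  λ (s , s′) → trans (cong (λ (j , j′) → d j , d′ j′) (Finₚ.remQuot-combine (e s) (e′ s′)))
    (cong₂ _,_ (de s) (de′ s′))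

module Game (em : ExcludedMiddle (lsuc 0ℓ)) (G : GameGraph) (I : Interval) where
  open GameGraph G
  open Classical em

  Moves : Set
  Moves = Subset (order ℕ.* order)

  -- Only Adam is confined to p, which contains a move u → v as combine u v.
  Restricted : Moves → V → V → ℤ → Set
  Restricted p u v z = Σ[ e ∈ Edge u v ] (z ≡ w e × (Owns G adam u → combine u v ∈ p))

  -- Unlike a Machine, a controller sees the current vertex besides its memory.
  record Controller : Set₁ where
    field
      S    : Set
      init : S
      step : S → V → V → S
      out  : S → (v : V) → ∃[ u ] Edge v u

  open Controller public

  data Run (p : Moves) (K : Controller) : S K → V → ℕ → ℤ → Set where
    begin : Run p K (init K) q₀ 0 0ℤ
    move  : ∀ {s u v k W z} → Run p K s u k W → Restricted p u v z →
      (Owns G eve u → v ≡ proj₁ (out K s u)) → Run p K (step K s u v) v (suc k) (W + z)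

  -- One constant `C` serves all runs. Finiteness of the memory is conditional, so that a single
  -- induction yields both halves of the theorem: for an irrational point Eve may count time.
  record EveWins (p : Moves) : Set₁ where
    field
      K      : Controller
      finite : NotIrrationalPoint I → Finite (S K)
      {a b}  : ℝ
      a∈I    : a ∈ᴵ I
      b∈I    : b ∈ᴵ I
      C      : ℕ
      within : ∀ {s v k W} → Run p K s v k W → Within a b C k W

  minimum : ∀ {a a′} → a ∈ᴵ I → a′ ∈ᴵ I → Σ[ m ∈ ℝ ] (m ∈ᴵ I × m ≤ a × m ≤ a′)
  minimum {a} {a′} a∈ a′∈ with ≤-or-> a a′
  ... | inj₁ a≤a′ = a , a∈ , (λ _ l → l) , a≤a′
  ... | inj₂ a′<a = a′ , a′∈ , <⇒≤ a′ a a′<a , (λ _ l → l)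

  maximum : ∀ {b b′} → b ∈ᴵ I → b′ ∈ᴵ I → Σ[ m ∈ ℝ ] (m ∈ᴵ I × b ≤ m × b′ ≤ m)
  maximum {b} {b′} b∈ b′∈ with ≤-or-> b b′
  ... | inj₁ b≤b′ = b′ , b′∈ , b≤b′ , (λ _ l → l)
  ... | inj₂ b′<b = b , b∈ , (λ _ l → l) , <⇒≤ b′ b b′<b

  -- Successors of `v` other than `u₁` and `u₂` are legal in both smaller games; excursions that
  -- begin with them go to the first controller.
  module Shuffle {p : Moves} {v u₁ u₂ : V} (v-adam : Owns G adam v) (u₁≢u₂ : u₁ ≢ u₂)
    (E₁ : EveWins (p ∖ combine v u₂)) (E₂ : EveWins (p ∖ combine v u₁)) where

    p₁ p₂ : Moves
    p₁ = p ∖ combine v u₂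
    p₂ = p ∖ combine v u₁

    module E₁ = EveWins E₁
    module E₂ = EveWins E₂
    K₁ = E₁.K
    K₂ = E₂.K

    restrict : ∀ {u u′ z y} → Restricted p u u′ z → ¬ (u ≡ v × u′ ≡ y) → Restricted (p ∖ combine v y) u u′ z
    restrict {u} {u′} {y = y} (e , z≡ , allowed) ≢vy = e , z≡ , λ o →
      x∈p∧x≢y⇒x∈p-y (allowed o) λ eq → ≢vy (Finₚ.combine-injective u u′ v y eq)

    -- A play that never reaches `v` cannot use the deleted move, so the second controller alone
    -- copes with all of `p`.
    unvisited : ¬ (∃[ s ] ∃[ k ] ∃[ W ] Run p₂ K₂ s v k W) → ∀ {s u k W} → Run p K₂ s u k W → Run p₂ K₂ s u k W
    unvisited never begin = begin
    unvisited never (move r e o) = move (unvisited never r)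
      (restrict e λ { (refl , _) → never (_ , _ , _ , unvisited never r) }) o

    module _ {s₂ : S K₂} {k₀ W₀} (visit : Run p₂ K₂ s₂ v k₀ W₀) where

      -- At v the successor decides which controller follows the next excursion.
      mode-after : Mode → V → V → Mode
      mode-after m u u′ with u Finₚ.≟ v | u′ Finₚ.≟ u₂
      ... | no _  | _     = m
      ... | yes _ | yes _ = second
      ... | yes _ | no _  = first

      step-in : Mode → S K₁ × S K₂ → V → V → S K₁ × S K₂
      step-in first  (s , s′) u u′ = step K₁ s u u′ , s′
      step-in second (s , s′) u u′ = s , step K₂ s′ u u′

      shuffled : Controller
      shuffled = record
        { S    = Mode × S K₁ × S K₂
        ; init = first , init K₁ , s₂
        ; step = λ (m , s) u u′ → mode-after m u u′ , step-in (mode-after m u u′) s u u′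
        ; out  = λ { (first , s , _) → out K₁ s ; (second , _ , s′) → out K₂ s′ }
        }

      -- The play that is not being continued waits at v.
      position₁ position₂ : Mode → V → V
      position₁ first  u = u
      position₁ second u = v
      position₂ first  u = v
      position₂ second u = u

      -- The second play begins with the run that led to its visit of v: hence the shift by k₀ and W₀.
      record Tracks (m : Mode) (s : S K₁) (s′ : S K₂) (u : V) (k : ℕ) (W : ℤ) : Set where
        field
          {k₁ k₂} : ℕ
          {W₁ W₂} : ℤ
          run₁    : Run p₁ K₁ s (position₁ m u) k₁ W₁
          run₂    : Run p₂ K₂ s′ (position₂ m u) k₂ W₂
          k-sum   : k₁ ℕ.+ k₂ ≡ k₀ ℕ.+ k
          W-sum   : W₁ + W₂ ≡ W₀ + W

      tracks-at-v : ∀ {m s s′ k W} m′ → Tracks m s s′ v k W → Tracks m′ s s′ v k W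
      tracks-at-v {m} m′ t = record
        { run₁ = subst (λ x → Run p₁ K₁ _ x _ _) (trans (at-v₁ m) (sym (at-v₁ m′))) run₁
        ; run₂ = subst (λ x → Run p₂ K₂ _ x _ _) (trans (at-v₂ m) (sym (at-v₂ m′))) run₂
        ; k-sum = k-sum ; W-sum = W-sum }
        where
        open Tracks t
        at-v₁ : ∀ m → position₁ m v ≡ v
        at-v₁ first  = refl
        at-v₁ second = refl
        at-v₂ : ∀ m → position₂ m v ≡ v
        at-v₂ first  = refl
        at-v₂ second = refl

      moves-of : Mode → Moves
      moves-of first  = p₁
      moves-of second = p₂

      -- The mode can change only at `v`, where both plays stand and either may go on. At Eve's
      -- vertices it is unchanged, as `v` belongs to Adam, so her move is the one output by the
      -- active controller.
      switch : ∀ {m s s′ u k W z} u′ → Tracks m s s′ u k W → Restricted p u u′ z →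
        Tracks (mode-after m u u′) s s′ u k W × Restricted (moves-of (mode-after m u u′)) u u′ z ×
        (Owns G eve u → mode-after m u u′ ≡ m)
      switch {m} {u = u} u′ t e with u Finₚ.≟ v | u′ Finₚ.≟ u₂
      ... | yes refl | yes refl = tracks-at-v second t , restrict e (λ (_ , eq) → u₁≢u₂ (sym eq)) ,
        λ o → contradiction (trans (sym o) v-adam) λ ()
      ... | yes refl | no u′≢u₂ = tracks-at-v first t , restrict e (λ (_ , eq) → u′≢u₂ eq) ,
        λ o → contradiction (trans (sym o) v-adam) λ ()
      switch {first}  u′ t e | no u≢v | _ = t , restrict e (λ (eq , _) → u≢v eq) , λ _ → refl
      switch {second} u′ t e | no u≢v | _ = t , restrict e (λ (eq , _) → u≢v eq) , λ _ → refl

      extend : ∀ m {s s′ u u′ k W z} → Tracks m s s′ u k W → Restricted (moves-of m) u u′ z →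
        (Owns G eve u → u′ ≡ proj₁ (out shuffled (m , s , s′) u)) →
        Tracks m (proj₁ (step-in m (s , s′) u u′)) (proj₂ (step-in m (s , s′) u u′)) u′ (suc k) (W + z)
      extend first {k = k} {W} {z} t e o = record
        { run₁ = move run₁ e o ; run₂ = run₂
        ; k-sum = trans (cong suc k-sum) (sym (ℕₚ.+-suc k₀ k))
        ; W-sum = trans (identity W₁ z W₂) (trans (cong (_+ z) W-sum) (ℤₚ.+-assoc W₀ W z)) }
        where
        open Tracks t
        identity : ∀ x z y → x + z + y ≡ x + y + z
        identity = solve-∀
      extend second {k = k} {W} {z} t e o = record
        { run₁ = run₁ ; run₂ = move run₂ e o
        ; k-sum = trans (ℕₚ.+-suc k₁ k₂) (trans (cong suc k-sum) (sym (ℕₚ.+-suc k₀ k)))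
        ; W-sum = trans (sym (ℤₚ.+-assoc W₁ W₂ z)) (trans (cong (_+ z) W-sum) (ℤₚ.+-assoc W₀ W z)) }
        where open Tracks t

      tracks : ∀ {m s s′ u k W} → Run p shuffled (m , s , s′) u k W → Tracks m s s′ u k W
      tracks begin = record { run₁ = begin ; run₂ = visit
        ; k-sum = sym (ℕₚ.+-identityʳ k₀) ; W-sum = trans (ℤₚ.+-identityˡ W₀) (sym (ℤₚ.+-identityʳ W₀)) }
      tracks (move {s = m , s , s′} {u} {u′} r e o) with switch u′ (tracks r) e
      ... | t , e′ , same = extend (mode-after m u u′) t e′ λ eve →
        trans (o eve) (cong (λ m → proj₁ (out shuffled (m , s , s′) u)) (sym (same eve)))

      shuffle-visited : EveWins p
      shuffle-visited with minimum E₁.a∈I E₂.a∈I | maximum E₁.b∈I E₂.b∈I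
      ... | a , a∈ , a≤₁ , a≤₂ | b , b∈ , ≤b₁ , ≤b₂ = record
        { K      = shuffled
        ; finite = λ ni → finite-× finite-Mode (finite-× (E₁.finite ni) (E₂.finite ni))
        ; a∈I    = a∈
        ; b∈I    = b∈
        ; C      = _
        ; within = λ r → combined (tracks r)
        }
        where
        combined : ∀ {m s s′ u k W} → Tracks m s s′ u k W → Within a b _ k W
        combined record { run₁ = run₁ ; run₂ = run₂ ; k-sum = k-sum ; W-sum = W-sum } =
          -- The sum of the two bounds is one for `k₀ + k` steps of weight `W₀ + W`. The run to the
          -- visit is fixed, so removing it costs a constant.
          proj₂ within-cancel k₀ W₀ (subst₂ (Within a b _) k-sum W-sum
            (within-+ (within-hull a≤₁ ≤b₁ (E₁.within run₁)) (within-hull a≤₂ ≤b₂ (E₂.within run₂))))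

    shuffle : EveWins p
    shuffle with em₀ (∃[ s ] ∃[ k ] ∃[ W ] Run p₂ K₂ s v k W)
    ... | yes (_ , _ , _ , visit) = shuffle-visited visit
    ... | no never = record { EveWins E₂ ; within = λ r → E₂.within (unvisited never r) }

-- Determinacy

≼-or-neg : ∀ {r k W} → ¬ (r · k ≼ W) → (ℚ.- r) · k ≼ - W
≼-or-neg {r} ¬≼ = neg-≼⁺ r (ℤₚ.<⇒≤ (ℤₚ.≰⇒> λ h → ¬≼ (≼⁺ h)))

bound₀ : ∀ {L : ℚ → Set} {k W} → (∀ {r} → L r → r · k ≼ W) → Bound L 0 k W
bound₀ {W = W} h = bound λ Lr → subst (_ · _ ≼_) (sym (ℤₚ.+-identityʳ W)) (h Lr)

<-neg⇒≤-neg : ∀ {p q} → p ℚ.< ℚ.- q → q ℚ.≤ ℚ.- p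
<-neg⇒≤-neg {p} {q} p<-q = subst (ℚ._≤ ℚ.- p) (⁻¹-involutive q) (ℚₚ.<⇒≤ (ℚₚ.neg-antimono-< p<-q))

below₀ : ∀ x {r k W} → lower x r → ↧ r * W ℤ.≤ ↥ r * + k → Below x 0 k W
below₀ x {r} l h = bound₀ λ u → ≼-mono (<-neg⇒≤-neg (lower<upper x l u)) (neg-≼⁺ r h)

above₀ : ∀ x {r k W} → upper x r → r · k ≼ W → Above x 0 k W
above₀ x u h = bound₀ λ l → ≼-mono (ℚₚ.<⇒≤ (lower<upper x l u)) h

within-exact : ∀ c {k W} → ↧ c * W ≡ ↥ c * + k → Within (fromℚ c) (fromℚ c) 0 k W
within-exact c eq =
  bound₀ (λ r<c → ≼-mono (ℚₚ.<⇒≤ r<c) (≼⁺ (ℤₚ.≤-reflexive (sym eq)))) ,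
  bound₀ (λ c<-r → ≼-mono (<-neg⇒≤-neg c<-r) (neg-≼⁺ c (ℤₚ.≤-reflexive eq)))

mean-exact : ∀ {l W} → let μ = W ℚ./ suc l in ↧ μ * W ≡ ↥ μ * + suc l
mean-exact {l} {W} = ℤₚ.≤-antisym
  (neg-≼⁻ μ {W = W} (/≤⇒neg-≼ (ℚₚ.≤-refl {μ}))) (≼⁻ (≤/⇒≼ {W = W} (ℚₚ.≤-refl {μ})))
  where μ = W ℚ./ suc l

neg-exact : ∀ c {k W} → ↧ c * W ≡ ↥ c * + k → ↧ (ℚ.- c) * (- W) ≡ ↥ (ℚ.- c) * + k
neg-exact c {k} {W} eq = subst₂ (λ d n → d * - W ≡ n * + k) (sym (ℚₚ.↧-neg c)) (sym (ℚₚ.↥-neg c))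
  (trans (sym (ℤₚ.neg-distribʳ-* (↧ c) W)) (trans (cong -_ eq) (ℤₚ.neg-distribˡ-* (↥ c) (+ k))))

module _ (em : ExcludedMiddle (lsuc 0ℓ)) where
  open Classical em
  open Cycles em

  -- The strict gap between the least mean and `r` pays for leading the minimal cycle through `v`.
  cycle-below : ∀ {n} {R : Fin n → Fin n → ℤ → Set} {v} (m : MinimalCycle {R = R} v) {r} →
    MinimalCycle.mean m ℚ.< r → ∃[ l ] ∃[ W ] (Walk R v v (suc l) W × ↧ r * W ℤ.≤ ↥ r * + suc l)
  cycle-below m {r} μ<r = detour-below {r = r}
    (ℤₚ.≰⇒> λ h → ℚₚ.<-irrefl refl (ℚₚ.<-≤-trans μ<r (subst (r ℚ.≤_) (sym mean≡) (≼⇒≤/ {W = W} (≼⁺ h)))))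
    (proj₂ (proj₂ to)) cycle (proj₂ (proj₂ from))
    where open MinimalCycle m

  -- A slope above `x` at which the upper bound on `W` failed would bound `W` from below, and with
  -- it every slope below `x` would do so.
  ¬above₀⇒below₀ : ∀ x {k W} → ¬ Above x 0 k W → Below x 0 k W
  ¬above₀⇒below₀ x {k} {W} ¬above = bound₀ below
    where
    below : ∀ {r} → upper x (ℚ.- r) → r · k ≼ - W
    below {r} u with em₀ (r · k ≼ - W)
    ... | yes h = h
    ... | no ¬h = contradiction (above₀ x u (subst (_ · _ ≼_) (ℤₚ.neg-involutive W) (≼-or-neg ¬h))) ¬above

module Solution (em : ExcludedMiddle (lsuc 0ℓ)) (G : GameGraph) (I : Interval) where
  open GameGraph G
  open Classical em
  open Cycles em
  open Game em G I

  owner : ∀ u → Owns G eve u ⊎ Owns G adam u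
  owner u with V∃ u
  ... | true  = inj₁ refl
  ... | false = inj₂ refl

  weights-bounded : ∃[ M ] (∀ {u v} (e : Edge u v) → ∣ w e ∣ ℕ.≤ M)
  weights-bounded = proj₁ all , λ {u} {v} e → proj₂ all u v e
    where
    each : ∀ u v → ∃[ M ] ((e : Edge u v) → ∣ w e ∣ ℕ.≤ M)
    each u v with em₀ (Edge u v)
    ... | yes e = ∣ w e ∣ , λ e′ → ℕₚ.≤-reflexive (cong (λ e → ∣ w {u} {v} e ∣) (Boolₚ.T-irrelevant e′ e))
    ... | no ¬e = 0 , λ e → contradiction e ¬e
    all = finite-max {P = λ u M → ∀ v (e : Edge u v) → ∣ w e ∣ ℕ.≤ M}
      (λ _ c≤c′ b v e → ℕₚ.≤-trans (b v e) c≤c′)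
      λ u → finite-max {P = λ v M → (e : Edge u v) → ∣ w e ∣ ℕ.≤ M}
        (λ _ c≤c′ b e → ℕₚ.≤-trans (b e) c≤c′) (each u)

  M = proj₁ weights-bounded

  restricted-bounded : ∀ {p u v z} → Restricted p u v z → ∣ z ∣ ℕ.≤ M
  restricted-bounded (e , refl , _) = proj₂ weights-bounded e

  -- Games in which Adam has no choice

  Forced : Moves → Set
  Forced p = ∀ {u x y z z′} → Owns G adam u → Restricted p u x z → Restricted p u y z′ → x ≡ y

  module Follow {p : Moves} (forced : Forced p) (ρ : ℕ → V) (ρ-start : ρ 0 ≡ q₀) (total-weight : ℕ → ℤ)
    (weight-start : total-weight 0 ≡ 0ℤ)
    (ρ-step : ∀ t → ∃[ z ] (Restricted p (ρ t) (ρ (suc t)) z × total-weight (suc t) ≡ total-weight t + z)) where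

    -- Eve's memory as a pointer into the path `ρ`. A step of the pointer has to preserve only the
    -- future of `ρ`, so that on a periodic path it may jump back.
    record Index : Set₁ where
      field
        Pos   : Set
        pos   : Pos → ℕ
        origin : Pos
        next  : Pos → Pos
        pos-origin : pos origin ≡ 0
        pos-next  : ∀ s j → ρ (j ℕ.+ pos (next s)) ≡ ρ (j ℕ.+ suc (pos s))

    module _ (ix : Index) where
      open Index ix

      follow-out : Pos → (v : V) → ∃[ u ] Edge v u
      follow-out s v with ρ (pos s) Finₚ.≟ v
      ... | yes refl = ρ (suc (pos s)) , proj₁ (proj₁ (proj₂ (ρ-step (pos s))))
      -- An arbitrary edge as default off the path; along a run the pointer always shows the current
      -- vertex.
      ... | no  _    = total v

      follow-out-on : ∀ s {v} → ρ (pos s) ≡ v → proj₁ (follow-out s v) ≡ ρ (suc (pos s))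
      follow-out-on s {v} eq with ρ (pos s) Finₚ.≟ v
      ... | yes refl = refl
      ... | no  ≢v   = contradiction eq ≢v

      follow : Controller
      follow = record { S = Pos ; init = origin ; step = λ s _ _ → next s ; out = follow-out }

      -- Eve copies `ρ` and Adam has only the move that `ρ` makes, so the run is an initial part of
      -- `ρ`. All futures from `pos s` and from `k` are compared, because a pointer that has jumped
      -- back no longer equals the time.
      follows : ∀ {s u k W} → Run p follow s u k W →
        u ≡ ρ k × W ≡ total-weight k × (∀ j → ρ (j ℕ.+ pos s) ≡ ρ (j ℕ.+ k))
      follows begin = sym ρ-start , sym weight-start , λ j → cong (λ i → ρ (j ℕ.+ i)) pos-origin
      follows (move {s} {u} {v} {k} {W} {z} r edge@(e , z≡ , allowed) o) with follows r | ρ-step k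
      ... | refl , refl , same | z′ , edge′@(e′ , z′≡ , allowed′) , weight≡ =
        v≡ , trans (cong (_+_ W) (z≡z′ e z≡ v≡)) (sym weight≡) , λ j → trans (pos-next s j)
          (trans (cong ρ (ℕₚ.+-suc j (pos s))) (trans (same (suc j)) (cong ρ (sym (ℕₚ.+-suc j k)))))
        where
        v≡ : v ≡ ρ (suc k)
        v≡ with owner (ρ k)
        ... | inj₁ is-eve  = trans (o is-eve) (trans (follow-out-on s (same 0)) (same 1))
        ... | inj₂ is-adam = forced is-adam edge edge′
        z≡z′ : ∀ {v z} (e : Edge (ρ k) v) → z ≡ w e → v ≡ ρ (suc k) → z ≡ z′
        z≡z′ e refl refl = trans (cong w (Boolₚ.T-irrelevant e e′)) (sym z′≡)

    follow-wins : (ix : Index) → (NotIrrationalPoint I → Finite (Index.Pos ix)) → ∀ {c C} → c ∈ᴵ I →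
      (∀ k → Within c c C k (total-weight k)) → EveWins p
    follow-wins ix finite c∈I within = record
      { K = follow ix ; finite = finite ; a∈I = c∈I ; b∈I = c∈I ; C = _
      ; within = λ r → let (_ , W≡ , _) = follows ix r in subst (Within _ _ _ _) (sym W≡) (within _) }

    time : Index
    time = record
      { Pos = ℕ ; pos = λ t → t ; origin = 0 ; next = suc ; pos-origin = refl ; pos-next = λ _ _ → refl }

    lasso : ∀ p d → (∀ j → ρ (j ℕ.+ (d ℕ.+ suc p)) ≡ ρ (j ℕ.+ p)) → Index
    lasso p d periodic = record
      { Pos = Fin (suc (d ℕ.+ p)) ; pos = toℕ ; origin = Fin.zero ; next = next
      ; pos-origin = refl ; pos-next = next-ok }
      where
      next : Fin (suc (d ℕ.+ p)) → Fin (suc (d ℕ.+ p))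
      next i with suc (toℕ i) ℕₚ.<? suc (d ℕ.+ p)
      ... | yes i<  = fromℕ< i<
      -- The last position `d + p` is followed by `p`, which has the same future as `d + suc p`.
      ... | no  _   = fromℕ< (ℕ.s≤s (ℕₚ.m≤n+m p d))
      next-ok : ∀ i j → ρ (j ℕ.+ toℕ (next i)) ≡ ρ (j ℕ.+ suc (toℕ i))
      next-ok i j with suc (toℕ i) ℕₚ.<? suc (d ℕ.+ p)
      ... | yes i<  = cong (λ t → ρ (j ℕ.+ t)) (Finₚ.toℕ-fromℕ< i<)
      ... | no  i≮  = trans (cong (λ t → ρ (j ℕ.+ t)) (Finₚ.toℕ-fromℕ< _)) (trans (sym (periodic j))
        (cong (λ t → ρ (j ℕ.+ t)) (trans (ℕₚ.+-suc d p) (sym (ℕₚ.≤-antisym (Finₚ.toℕ<n i) (ℕₚ.≮⇒≥ i≮))))))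

  module _ {p : Moves} (forced : Forced p) {v : V} (reach : Reaches (Restricted p) q₀ v) where
    open Looping {R = Restricted p} v

    c₀ : Cursor
    c₀ = q₀ , reach

    -- The invariant concerns the end of the walk in progress, which is at most `m` steps away.
    -- Cancelling these steps costs at most `q * m` for their length and `M * m` for their weight.
    loops-within : ∀ {c} (choose : ℕ → ℤ → Loop) m C → Within c c C (remaining c₀) (remaining-weight c₀) →
      remaining c₀ ℕ.≤ m →
      (∀ k W → Within c c C k W → let (l , W′ , _) = choose k W in
        Within c c C (k ℕ.+ suc l) (W + W′) × suc l ℕ.≤ m) →
      ∃[ C′ ] (∀ t → Within c c C′ t (gained choose c₀ t))
    loops-within {c} choose m C within₀ c₀≤m within-step = C ℕ.+ (q ℕ.* m ℕ.+ M ℕ.* m) , within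
      where
      q = proj₁ (within-cancel {c} {c})

      within : ∀ t → Within c c (C ℕ.+ (q ℕ.* m ℕ.+ M ℕ.* m)) t (gained choose c₀ t)
      within t with cursor choose c₀ t | looping-invariant choose c₀ (Within c c C) m within₀ c₀≤m within-step t
      ... | _ , l , W , γ | inv , l≤m = within-weaken
        (ℕₚ.+-monoʳ-≤ C (ℕₚ.+-mono-≤ (ℕₚ.*-monoʳ-≤ q l≤m)
          (ℕₚ.≤-trans (weight-bound restricted-bounded γ) (ℕₚ.*-monoʳ-≤ M l≤m))))
        (proj₂ (within-cancel {c} {c}) l W
          (subst₂ (Within c c C) (ℕₚ.+-comm t l) (ℤₚ.+-comm (gained choose c₀ t) W) inv))

    cycle-wins : ∀ c → fromℚ c ∈ᴵ I → ∀ {l W} → Walk (Restricted p) v v (suc l) W →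
      ↧ c * W ≡ ↥ c * + suc l → EveWins p
    cycle-wins c c∈I {l} {W} γ exact =
      let (q , d , periodic) = looping-periodic L c₀ in
      follow-wins (lasso q d periodic) (λ _ → finite-Fin _) c∈I (proj₂ bounded)
      where
      L : Loop
      L = l , W , γ
      m = remaining c₀ ℕ.+ suc l
      start-within = within-exists {fromℚ c} {fromℚ c} (remaining c₀) (remaining-weight c₀)
      bounded = loops-within {fromℚ c} (λ _ _ → L) m (proj₁ start-within) (proj₂ start-within) (ℕₚ.m≤m+n _ _)
        -- A round of mean exactly `c` has constant 0, so the constant does not grow with the number
        -- of rounds.
        λ k W′ inv → subst (λ C → Within _ _ C (k ℕ.+ suc l) (W′ + W)) (ℕₚ.+-identityʳ _)
          (within-+ inv (within-exact c exact)) , ℕₚ.m≤n+m _ _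
      open Follow forced (λ t → here (cursor (λ _ _ → L) c₀ t)) refl (gained (λ _ _ → L) c₀) refl
        (looping-step (λ _ _ → L) c₀)

    -- Taking the lighter cycle when W ≥ c · k and the heavier one otherwise keeps W - c · k bounded.
    greedy-wins : ∀ c → c ∈ᴵ I → ¬ NotIrrationalPoint I →
      ∀ {lᵃ Wᵃ} → Walk (Restricted p) v v (suc lᵃ) Wᵃ → Below c 0 (suc lᵃ) Wᵃ →
      ∀ {lᵇ Wᵇ} → Walk (Restricted p) v v (suc lᵇ) Wᵇ → Above c 0 (suc lᵇ) Wᵇ → EveWins p
    greedy-wins c c∈I irrational {lᵃ} {Wᵃ} γᵃ belowᵃ {lᵇ} {Wᵇ} γᵇ aboveᵇ =
      follow-wins time (λ ni → contradiction ni irrational) c∈I (proj₂ bounded)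
      where
      A B : Loop
      A = lᵃ , Wᵃ , γᵃ
      B = lᵇ , Wᵇ , γᵇ

      pick : ∀ {k W} → Dec (Above c 0 k W) → Loop
      pick (yes _) = A
      pick (no _)  = B

      choose : ℕ → ℤ → Loop
      choose k W = pick (em₀ (Above c 0 k W))

      m = remaining c₀ ℕ.+ (suc lᵃ ℕ.+ suc lᵇ)
      within₀ = within-exists {c} {c} (remaining c₀) (remaining-weight c₀)
      withinᵃ = within-exists {c} {c} (suc lᵃ) Wᵃ
      withinᵇ = within-exists {c} {c} (suc lᵇ) Wᵇ
      C₀ = proj₁ within₀
      Cᵃ = proj₁ withinᵃ
      Cᵇ = proj₁ withinᵇ
      -- `C₀` pays for the way to `v`, and `Cᵃ` and `Cᵇ` for the overshoot by a single loop past
      -- slope `c`.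
      C  = C₀ ℕ.+ (Cᵃ ℕ.+ Cᵇ)

      within-step : ∀ k W → Within c c C k W → let (l , W′ , _) = choose k W in
        Within c c C (k ℕ.+ suc l) (W + W′) × suc l ℕ.≤ m
      within-step k W (above , below) with em₀ (Above c 0 k W)
      ... | yes above₀ =
        (bound-weaken (ℕₚ.≤-trans (ℕₚ.m≤m+n Cᵃ Cᵇ) (ℕₚ.m≤n+m _ C₀)) (bound-+ above₀ (is-above (proj₂ withinᵃ))) ,
         bound-weaken (ℕₚ.≤-reflexive (ℕₚ.+-identityʳ C)) (below-+ c {W = W} {Wᵃ} below belowᵃ)) ,
        ℕₚ.≤-trans (ℕₚ.m≤m+n (suc lᵃ) (suc lᵇ)) (ℕₚ.m≤n+m _ (remaining c₀))
      ... | no ¬above₀ =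
        (bound-weaken (ℕₚ.≤-reflexive (ℕₚ.+-identityʳ C)) (bound-+ above aboveᵇ) ,
         bound-weaken (ℕₚ.≤-trans (ℕₚ.m≤n+m Cᵇ Cᵃ) (ℕₚ.m≤n+m _ C₀))
           (below-+ c {W = W} {Wᵇ} (¬above₀⇒below₀ em c ¬above₀) (is-below (proj₂ withinᵇ)))) ,
        ℕₚ.≤-trans (ℕₚ.m≤n+m (suc lᵇ) (suc lᵃ)) (ℕₚ.m≤n+m _ (remaining c₀))

      bounded = loops-within {c} choose m C (within-weaken (ℕₚ.m≤m+n C₀ _) (proj₂ within₀))
        (ℕₚ.m≤m+n _ _) within-step
      open Follow forced (λ t → here (cursor choose c₀ t)) refl (gained choose c₀) refl (looping-step choose c₀)

  -- If `x` is the only point of `I`, it is rational by assumption. Otherwise `I` contains a second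
  -- point, and a rational `s` between the two is in `I` by convexity; on the far side of `r₂` or
  -- `r₁` it is replaced by that end, which then lies between the two points as well.
  rational-point : NotIrrationalPoint I → ∀ {x} → x ∈ᴵ I → ∀ {r₁ r₂} → lower x r₁ → upper x r₂ →
    ∃[ c ] (fromℚ c ∈ᴵ I × r₁ ℚ.≤ c × c ℚ.≤ r₂)
  rational-point ni {x} x∈I {r₁} {r₂} l u with em {Σ[ y ∈ ℝ ] (y ∈ᴵ I × ¬ (y ≈ x))}
  ... | no alone = at-q (ni x x∈I λ y y∈I → decidable-stable (em₀ (y ≈ x)) λ y≉x → alone (y , y∈I , y≉x))
    where
    at-q : ∃[ q ] x ≈ fromℚ q → ∃[ c ] (fromℚ c ∈ᴵ I × r₁ ℚ.≤ c × c ℚ.≤ r₂)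
    at-q (q , x≤q , q≤x) = q , ∈ᴵ-convex I x∈I x∈I x≤q q≤x , ℚₚ.<⇒≤ (x≤q r₁ l) ,
      ℚₚ.<⇒≤ (≤-upper {fromℚ q} {x} q≤x u)
  ... | yes (y , y∈I , y≉x) with ≤-or-> y x
  ...   | inj₂ (s , ux , ly) with ℚₚ.≤-total s r₂
  ...     | inj₁ s≤r₂ = s , ∈ᴵ-convex I x∈I y∈I (≤-fromℚ {x} ux) (fromℚ-≤ {y} ly) ,
    ℚₚ.<⇒≤ (lower<upper x l ux) , s≤r₂
  ...     | inj₂ r₂≤s = r₂ , ∈ᴵ-convex I x∈I y∈I (≤-fromℚ {x} u) (fromℚ-≤ {y} (lower-≤ y r₂≤s ly)) ,
    ℚₚ.<⇒≤ (lower<upper x l u) , ℚₚ.≤-refl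
  rational-point ni {x} x∈I {r₁} {r₂} l u | yes (y , y∈I , y≉x) | inj₁ y≤x with ≤-or-> x y
  ... | inj₁ x≤y = contradiction (y≤x , x≤y) y≉x
  ... | inj₂ (s , uy , lx) with ℚₚ.≤-total s r₁
  ...   | inj₁ s≤r₁ = r₁ , ∈ᴵ-convex I y∈I x∈I (≤-fromℚ {y} (upper-≤ y s≤r₁ uy)) (fromℚ-≤ {x} l) ,
    ℚₚ.≤-refl , ℚₚ.<⇒≤ (lower<upper x l u)
  ...   | inj₂ r₁≤s = s , ∈ᴵ-convex I y∈I x∈I (≤-fromℚ {y} uy) (fromℚ-≤ {x} lx) ,
    r₁≤s , ℚₚ.<⇒≤ (lower<upper x lx u)

  -- Negating the weights turns greatest cycle means into least ones, so one construction gives both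
  -- extremes.
  Negated : Moves → V → V → ℤ → Set
  Negated p u v z = Restricted p u v (- z)

  module OnePlayer {p : Moves} (forced : Forced p) (π : Play G)
    (legal : ∀ t → Restricted p (Play.vertex π t) (Play.vertex π (suc t)) (w (Play.step π t)))
    {x : ℝ} (payoff : IsMeanPayoff G π x) (x∈I : x ∈ᴵ I)
    (N : ℕ) (recurs : ∀ i → N ℕ.≤ i → ∀ j → ∃[ t ] (j ℕ.≤ t × Play.vertex π t ≡ Play.vertex π i)) where

    ρ : ℕ → V
    ρ = Play.vertex π

    v : V
    v = ρ N

    ρ-step : ∀ t → ∃[ z ] (Restricted p (ρ t) (ρ (suc t)) z × weight G π (suc t) ≡ weight G π t + z)
    ρ-step t = _ , legal t , refl

    ρ-step⁻ : ∀ t → ∃[ z ] (Negated p (ρ t) (ρ (suc t)) z × - weight G π (suc t) ≡ - weight G π t + z)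
    ρ-step⁻ t = - w (Play.step π t) ,
      subst (Restricted p (ρ t) (ρ (suc t))) (sym (ℤₚ.neg-involutive _)) (legal t) ,
      ℤₚ.neg-distrib-+ (weight G π t) (w (Play.step π t))

    negate : ∀ {u u′ z} → Restricted p u u′ z → Negated p u u′ (- z)
    negate = subst (Restricted p _ _) (sym (ℤₚ.neg-involutive _))

    reach : Reaches (Restricted p) q₀ v
    reach = subst (λ u → Reaches (Restricted p) u v) (Play.starts π) (path ρ (weight G π) ρ-step ℕ.z≤n)

    back : ∀ i → N ℕ.≤ i → Reaches (Restricted p) (ρ i) v
    back i N≤i with recurs N ℕₚ.≤-refl i
    ... | t , i≤t , ρt≡v = subst (Reaches (Restricted p) (ρ i)) ρt≡v (path ρ (weight G π) ρ-step i≤t)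

    neg-reaches : ∀ {u u′} → Reaches (Restricted p) u u′ → Reaches (Negated p) u u′
    neg-reaches (_ , _ , γ) = _ , _ , map-neg negate γ

    reaches-neg : ∀ {u u′} → Reaches (Negated p) u u′ → Reaches (Restricted p) u u′
    reaches-neg (_ , _ , γ) = _ , _ , map-neg (λ e → e) γ

    closed : ∃[ l ] ∃[ W ] Walk (Restricted p) v v (suc l) W
    closed = let (_ , _ , γ) = back (suc N) (ℕₚ.n≤1+n N) in _ , _ , legal N ∷ γ

    minᵃ : MinimalCycle {R = Restricted p} v
    minᵃ = minimal-cycle {R = Restricted p} M restricted-bounded closed

    minᵇ : MinimalCycle {R = Negated p} v
    minᵇ = minimal-cycle {R = Negated p} M
      (λ {_} {_} {z} e → subst (ℕ._≤ M) (ℤₚ.∣-i∣≡∣i∣ z) (restricted-bounded e))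
      (let (l , _ , γ) = closed in l , _ , map-neg negate γ)

    module Between (minᵃ : MinimalCycle {R = Restricted p} v) (minᵇ : MinimalCycle {R = Negated p} v) where
      module A = MinimalCycle minᵃ
      module B = MinimalCycle minᵇ

      μᵃ μᵇ : ℚ
      μᵃ = A.mean
      μᵇ = ℚ.- B.mean

      μᵃ≤x : fromℚ μᵃ ≤ x
      μᵃ≤x = bounded⇒liminf-≥ (weight G π) {a = fromℚ μᵃ} {x} payoff
        (proj₂ (tail-bound ρ (weight G π) ρ-step N A.minimal back))

      x≤μᵇ : x ≤ fromℚ μᵇ
      x≤μᵇ = bounded⇒liminf-≤ (weight G π) {b = fromℚ μᵇ} {x} payoff λ j N≤j → bound λ μᵇ<-r →
        bound-at (proj₂ tail j N≤j) (subst₂ ℚ._<_ (⁻¹-involutive _) (⁻¹-involutive _) (ℚₚ.neg-antimono-< μᵇ<-r))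
        where
        tail = tail-bound ρ (λ t → - weight G π t) ρ-step⁻ N B.minimal (λ i N≤i → neg-reaches (back i N≤i))

      cycleᵃ : ∀ {r} → μᵃ ℚ.< r → ∃[ l ] ∃[ W ] (Walk (Restricted p) v v (suc l) W × ↧ r * W ℤ.≤ ↥ r * + suc l)
      cycleᵃ = cycle-below em minᵃ

      cycleᵇ : ∀ {r} → r ℚ.< μᵇ → ∃[ l ] ∃[ W ] (Walk (Restricted p) v v (suc l) W × r · suc l ≼ W)
      cycleᵇ {r} r<μᵇ with cycle-below em minᵇ {ℚ.- r}
        (subst (ℚ._< ℚ.- r) (⁻¹-involutive B.mean) (ℚₚ.neg-antimono-< r<μᵇ))
      ... | l , W , γ , h = l , - W , map-neg (λ e → e) γ ,
        subst (_· suc l ≼ - W) (⁻¹-involutive r) (neg-≼⁺ (ℚ.- r) h)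

      between : EveWins p
      between with ≤-or-> x (fromℚ μᵃ) | ≤-or-> (fromℚ μᵇ) x
      -- Here `x` is the least cycle mean itself, a rational point of `I`, and Eve repeats the
      -- minimal cycle.
      ... | inj₁ x≤μᵃ | _ = cycle-wins forced (reaches-trans reach A.to) μᵃ
        (∈ᴵ-convex I x∈I x∈I x≤μᵃ μᵃ≤x) A.cycle
        (subst (λ μ → ↧ μ * A.W ≡ ↥ μ * + suc A.l) (sym A.mean≡) (mean-exact {W = A.W}))
      ... | inj₂ _ | inj₁ μᵇ≤x = cycle-wins forced (reaches-trans reach (reaches-neg B.to)) μᵇ
        (∈ᴵ-convex I x∈I x∈I x≤μᵇ μᵇ≤x) (map-neg (λ e → e) B.cycle)
        (neg-exact B.mean {W = B.W}
          (subst (λ μ → ↧ μ * B.W ≡ ↥ μ * + suc B.l) (sym B.mean≡) (mean-exact {W = B.W})))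
      -- Now `μᵃ < r₁ < x < r₂ < μᵇ`, so for each slope from `r₁` to `r₂` there are closed walks at
      -- `v` on either side of it.
      ... | inj₂ (r₁ , μᵃ<r₁ , l) | inj₂ (r₂ , u , r₂<μᵇ) with em {NotIrrationalPoint I}
      ...   | yes ni = balance (rational-point ni x∈I l u)
        where
        balance : ∃[ c ] (fromℚ c ∈ᴵ I × r₁ ℚ.≤ c × c ℚ.≤ r₂) → EveWins p
        balance (c , c∈I , r₁≤c , c≤r₂) =
          let (_ , _ , γᵃ , hᵃ) = cycleᵃ (ℚₚ.<-≤-trans μᵃ<r₁ r₁≤c)
              (_ , _ , γᵇ , hᵇ) = cycleᵇ (ℚₚ.≤-<-trans c≤r₂ r₂<μᵇ)
              (_ , _ , γ , exact) = balanced-cycle {c = c} γᵃ hᵃ γᵇ (≼⁻ hᵇ)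
          in cycle-wins forced reach c c∈I γ exact
      ...   | no irrational =
        let (_ , _ , γᵃ , hᵃ) = cycleᵃ μᵃ<r₁
            (_ , _ , γᵇ , hᵇ) = cycleᵇ r₂<μᵇ
        in greedy-wins forced reach x x∈I irrational γᵃ (below₀ x l hᵃ) γᵇ (above₀ x u hᵇ)

    one-player : EveWins p
    one-player = Between.between minᵃ minᵇ

  -- Induction on the moves left to Adam

  AdamWinsPositionally : Set₁
  AdamWinsPositionally = Σ[ σ ∈ Strategy G adam ] (Positional G {adam} σ × Winning G I {adam} σ)

  Unblocked : Moves → Set
  Unblocked p = ∀ u → Owns G adam u → ∃[ v ] (Edge u v × combine u v ∈ p)

  -- Picking a remaining move at every vertex of Adam gives a positional strategy of the whole game.
  -- It does not win, and a play that refutes it stays within `p`.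
  forced-case : ¬ AdamWinsPositionally → ∀ {p} → Forced p → Unblocked p → EveWins p
  forced-case ¬adam {p} forced unblocked = answer em
    where
    pick : ∀ v → ∃[ u ] (Edge v u × (Owns G adam v → combine v u ∈ p))
    pick v with owner v
    ... | inj₁ is-eve  = let (u , e) = total v in
      u , e , λ is-adam → contradiction (trans (sym is-eve) is-adam) λ ()
    ... | inj₂ is-adam = let (u , e , u∈p) = unblocked v is-adam in u , e , λ _ → u∈p

    σ : Strategy G adam
    σ {v} _ _ = proj₁ (pick v) , proj₁ (proj₂ (pick v))

    answer : Dec (Σ[ π ∈ Play G ] (Consistent G {adam} σ π × WonBy G I eve π)) → EveWins p
    answer (no none) = contradiction
      (σ , ((λ v → proj₁ (pick v)) , λ _ _ → refl) , λ π consistent won → none (π , consistent , won)) ¬adam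
    answer (yes (π , consistent , x , payoff , x∈I)) =
      let (N , recurs) = recurrent vertex in OnePlayer.one-player forced π legal payoff x∈I N recurs
      where
      open Play π using (vertex) renaming (step to edge)
      legal : ∀ t → Restricted p (vertex t) (vertex (suc t)) (w (edge t))
      legal t = edge t , refl , λ o →
        subst (λ u → combine (vertex t) u ∈ p) (sym (consistent t o)) (proj₂ (proj₂ (pick (vertex t))) o)

  eve-wins : ¬ AdamWinsPositionally → ∀ p → Acc _⊂_ p → Unblocked p → EveWins p
  eve-wins ¬adam p (acc smaller) unblocked with em₀ (∃[ v ] ∃[ u₁ ] ∃[ u₂ ] (Owns G adam v × u₁ ≢ u₂ ×
    (Edge v u₁ × combine v u₁ ∈ p) × (Edge v u₂ × combine v u₂ ∈ p)))
  ... | no none = forced-case ¬adam (λ {u} {x} {y} → forced {u} {x} {y}) unblocked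
    where
    forced : Forced p
    forced {u} {x} {y} is-adam (e , _ , allowed) (e′ , _ , allowed′) with x Finₚ.≟ y
    ... | yes x≡y = x≡y
    ... | no  x≢y = contradiction
      (u , x , y , is-adam , x≢y , (e , allowed is-adam) , (e′ , allowed′ is-adam)) none
  ... | yes (v , u₁ , u₂ , is-adam , u₁≢u₂ , move₁ , move₂) = Shuffle.shuffle is-adam u₁≢u₂
    (eve-wins ¬adam _ (smaller (x∈p⇒p-x⊂p (proj₂ move₂))) (keep move₁ u₁≢u₂))
    (eve-wins ¬adam _ (smaller (x∈p⇒p-x⊂p (proj₂ move₁))) (keep move₂ (λ eq → u₁≢u₂ (sym eq))))
    where
    -- Of two moves at `v` only one is deleted, so Adam is never stuck.
    keep : ∀ {y y′} → Edge v y × combine v y ∈ p → y ≢ y′ → Unblocked (p ∖ combine v y′)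
    keep {y} {y′} (e , y∈p) y≢y′ u is-adam with u Finₚ.≟ v
    ... | yes refl = y , e , x∈p∧x≢y⇒x∈p-y y∈p (λ eq → y≢y′ (Finₚ.combine-injectiveʳ v y v y′ eq))
    ... | no u≢v   = let (x , e , x∈p) = unblocked u is-adam in
      x , e , x∈p∧x≢y⇒x∈p-y x∈p (λ eq → u≢v (Finₚ.combine-injectiveˡ u x v y′ eq))

  -- From controllers to strategies

  module Play-out (E : EveWins full) where
    open EveWins E

    memory : ∀ {v} → Prefix G v → S K
    memory (start _)           = init K
    memory (_▷_ {u} {v} h _) = step K (memory h) u v

    strategy : Strategy G eve
    strategy {v} h _ = out K (memory h) v

    run-of : ∀ π → Consistent G {eve} strategy π → ∀ k →
      Run full K (memory (prefix G π k)) (Play.vertex π k) k (weight G π k)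
    run-of π consistent zero    = subst (λ v → Run full K (init K) v 0 0ℤ) (sym (Play.starts π)) begin
    run-of π consistent (suc k) = move (run-of π consistent k) (Play.step π k , refl , λ _ → ∈⊤) (consistent k)

    winning : Winning G I {eve} strategy
    winning π consistent = x , payoff , ∈ᴵ-convex I a∈I b∈I
      (bounded⇒liminf-≥ (weight G π) {a} {x} {N = 0} payoff (λ k _ → is-above (bounds k)))
      (bounded⇒liminf-≤ (weight G π) {b} {x} {N = 0} payoff (λ k _ → is-below (bounds k)))
      where
      bounds : ∀ k → Within a b C k (weight G π k)
      bounds k = within (run-of π consistent k)
      linear : ∀ k → ∣ weight G π k ∣ ℕ.≤ M ℕ.* k
      linear zero    = ℕ.z≤n
      linear (suc k) = ℕₚ.≤-trans (ℤₚ.∣i+j∣≤∣i∣+∣j∣ (weight G π k) (w (Play.step π k)))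
        (subst (∣ weight G π k ∣ ℕ.+ ∣ w (Play.step π k) ∣ ℕ.≤_) (trans (ℕₚ.+-comm _ M) (sym (ℕₚ.*-suc M k)))
          (ℕₚ.+-mono-≤ (linear k) (proj₂ weights-bounded (Play.step π k))))
      limit : Σ[ x ∈ ℝ ] Liminf (weight G π) x
      limit = bounded⇒liminf (weight G π) M linear
      x = proj₁ limit
      payoff = proj₂ limit

    -- A machine outputs from its state alone and is fed one vertex at a time, whereas the
    -- controller sees both ends of a move. The state therefore stores the current vertex along with
    -- the memory, with one extra state for the time before the first vertex.
    finite-memory : NotIrrationalPoint I → FiniteMemory G {eve} strategy
    finite-memory ni with finite ni
    ... | n , encode , decode , decode-encode = machine ,
        λ {v} h _ → sym (trans (cong (Machine.output machine) (reads h)) (output-ok (memory h) v))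
      where
      decoded : Fin (n ℕ.* order) → S K × V
      decoded i = let (j , u) = remQuot order i in decode j , u

      code : S K → V → Fin (suc (n ℕ.* order))
      code s u = Fin.suc (combine (encode s) u)

      machine : Machine G
      machine = record
        { size    = suc (n ℕ.* order)
        ; initial = Fin.zero
        ; update  = λ { Fin.zero v → code (init K) v
                      ; (Fin.suc i) v → let (s , u) = decoded i in code (step K s u v) v }
        -- No prefix ends in the initial state, as at least one vertex has been read; `q₀` is a
        -- placeholder.
        ; output  = λ { Fin.zero → q₀ ; (Fin.suc i) → let (s , u) = decoded i in proj₁ (out K s u) }
        }

      decoded-code : ∀ s u → decoded (combine (encode s) u) ≡ (s , u)
      decoded-code s u = trans (cong (λ (j , u) → decode j , u) (Finₚ.remQuot-combine (encode s) u))
        (cong (_, u) (decode-encode s))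

      output-ok : ∀ s u → Machine.output machine (code s u) ≡ proj₁ (out K s u)
      output-ok s u = cong (λ (s , u) → proj₁ (out K s u)) (decoded-code s u)

      reads : ∀ {v} (h : Prefix G v) → run G machine h ≡ code (memory h) v
      reads (start _)           = refl
      reads (_▷_ {u} {v} h e) = trans (cong (λ i → Machine.update machine i v) (reads h))
        (cong (λ (s , u) → code (step K s u v) v) (decoded-code (memory h) u))

  module Versus (σ : Strategy G adam) (τ : Strategy G eve) where

    reply : ∀ {v} → Prefix G v → ∃[ u ] Edge v u
    reply {v} h with owner v
    ... | inj₁ is-eve  = τ h is-eve
    ... | inj₂ is-adam = σ h is-adam

    history : ℕ → ∃[ v ] Prefix G v
    history zero    = q₀ , start refl
    history (suc k) = let (v , h) = history k ; (u , e) = reply h in u , h ▷ e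

    play : Play G
    play = record
      { vertex = λ k → proj₁ (history k)
      ; starts = refl
      ; step   = λ k → proj₂ (reply (proj₂ (history k))) }

    prefix-play : ∀ k → prefix G play k ≡ proj₂ (history k)
    prefix-play zero    = refl
    prefix-play (suc k) = cong (_▷ Play.step play k) (prefix-play k)

    consistent-eve : Consistent G {eve} τ play
    consistent-eve k o rewrite prefix-play k with history k
    ... | v , h with owner v
    -- Strategies take a proof of ownership as an argument; such proofs are equalities of Booleans,
    -- hence unique.
    ...   | inj₁ is-eve  = cong (λ o → proj₁ (τ h o)) (≡-irrelevant is-eve o)
    ...   | inj₂ is-adam = contradiction (trans (sym o) is-adam) λ ()

    consistent-adam : Consistent G {adam} σ play
    consistent-adam k o rewrite prefix-play k with history k
    ... | v , h with owner v
    ...   | inj₁ is-eve  = contradiction (trans (sym is-eve) o) λ ()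
    ...   | inj₂ is-adam = cong (λ o → proj₁ (σ h o)) (≡-irrelevant is-adam o)

  -- The play of both strategies against each other would be won by both players. Thus a winning
  -- strategy of one player rules out the alternative of the dichotomy that favours the other.
  not-both : (σ : Strategy G adam) (τ : Strategy G eve) → Winning G I {adam} σ → ¬ Winning G I {eve} τ
  not-both σ τ σ-wins τ-wins = σ-wins play consistent-adam (τ-wins play consistent-eve)
    where open Versus σ τ

  dichotomy : AdamWinsPositionally ⊎ EveWins full
  dichotomy with em {AdamWinsPositionally}
  ... | yes adam-wins = inj₁ adam-wins
  ... | no  ¬adam     = inj₂ (eve-wins ¬adam full (⊂-wellFounded full) λ u _ → let (v , e) = total u in v , e , ∈⊤)

mainTheorem7 : ExcludedMiddle (lsuc 0ℓ) → (G : GameGraph) (I : Interval) →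
    ( (Σ[ σ ∈ Strategy G adam ] Winning G I {adam} σ) →
    Σ[ σ ∈ Strategy G adam ] (Positional G {adam} σ × Winning G I {adam} σ) )
    ×
    ( NotIrrationalPoint I →
    (Σ[ σ ∈ Strategy G eve ] Winning G I {eve} σ) →
    Σ[ σ ∈ Strategy G eve ] (FiniteMemory G {eve} σ × Winning G I {eve} σ) )
mainTheorem7 em G I = adam-part dichotomy , λ ni → eve-part ni dichotomy
  where
  open Solution em G I
  open Game em G I

  adam-part : AdamWinsPositionally ⊎ EveWins full →
    (Σ[ σ ∈ Strategy G adam ] Winning G I {adam} σ) → AdamWinsPositionally
  adam-part (inj₁ adam-wins) _ = adam-wins
  adam-part (inj₂ E) (σ , σ-wins) =
    contradiction (Play-out.winning E) (not-both σ (Play-out.strategy E) σ-wins)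

  eve-part : NotIrrationalPoint I → AdamWinsPositionally ⊎ EveWins full →
    (Σ[ σ ∈ Strategy G eve ] Winning G I {eve} σ) →
    Σ[ σ ∈ Strategy G eve ] (FiniteMemory G {eve} σ × Winning G I {eve} σ)
  eve-part ni (inj₁ (σ , _ , σ-wins)) (τ , τ-wins) = contradiction τ-wins (not-both σ τ σ-wins)
  eve-part ni (inj₂ E) _ = Play-out.strategy E , Play-out.finite-memory E ni , Play-out.winning E
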